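{- Let $k\geq 2$ be an integer, and let $G$ be a graph of order $n$ with minimum degree $\delta\geq 1$. Suppose that for every independent set $\{x_1,x_2,\ldots,x_{\lfloor(k+\frac{1}{2})\delta\rfloor+1}\}$ of $\lfloor(k+\frac{1}{2})\delta\rfloor+1$ vertices of $G$, $$\max\{d_G(x_1),d_G(x_2),\ldots,d_G(x_{\lfloor(k+\frac{1}{2})\delta\rfloor+1})\}\geq\frac{2n}{2k+3}.$$ Then $G$ has a $\{K_{1,1},K_{1,2},\ldots,K_{1,k},\mathcal{T}(2k+1)\}$-factor.
   Context: All graphs are finite, undirected, without loops or multiple edges; $d_G(x)$ is the degree of $x$ in $G$. $K_{1,j}$ denotes the star with $j$ leaves. For a set $\mathcal{H}$ of connected graphs, an $\mathcal{H}$-factor of $G$ is a spanning subgraph of $G$ each of whose connected components is isomorphic to an element of $\mathcal{H}$. The family $\mathcal{T}(2k+1)$ ($k\geq2$) is defined as follows. For a tree $T$, $Leaf(T)$ is its set of leaves. Let $R$ be a tree such that for every $x\in V(R)\setminus Leaf(R)$: (a) $d_{R-Leaf(R)}(x)\in\{1,3,\ldots,2k+1\}$, and (b) $2\cdot(\text{number of leaves of } R \text{ adjacent to } x)+d_{R-Leaf(R)}(x)\leq 2k+1$. From such $R$ build a tree $T_R$ by (c) inserting a new vertex of degree 2 into each edge of $R-Leaf(R)$, and (d) for every vertex $x$ of $R-Leaf(R)$ with $d_{R-Leaf(R)}(x)=2r+1<2k+1$, attaching $k-r-(\text{number of leaves of } R \text{ adjacent to } x)$ new pendant edges to $x$. Then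 $\mathcal{T}(2k+1)$ is the set of all trees $T_R$ over all trees $R$ satisfying (a) and (b). A $\{K_{1,1},\ldots,K_{1,k},\mathcal{T}(2k+1)\}$-factor is an $\mathcal{H}$-factor with $\mathcal{H}=\{K_{1,1},\ldots,K_{1,k}\}\cup\mathcal{T}(2k+1)$. -}

module Defs where

open import Data.Nat using (ℕ; zero; suc; _+_; _*_; _∸_; _≤_; _<ᵇ_; _≡ᵇ_; _⊔_)
open import Data.Nat.DivMod using (_/_)
open import Data.Bool using (Bool; true; false; _∧_; _∨_; _xor_; not; if_then_else_; T)
open import Data.Fin using (Fin; zero; suc; toℕ; inject₁; fromℕ; _≟_)
open import Data.Product using (Σ; Σ-syntax; ∃; ∃-syntax; _×_; _,_)
open import Data.Sum using (_⊎_; inj₁; inj₂)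
open import Data.Empty using (⊥)
open import Function using (_∘_; _⇔_; _↔_; Inverse)
open import Function.Definitions using (Injective)
open import Relation.Nullary.Decidable using (⌊_⌋)
open import Relation.Binary.PropositionalEquality using (_≡_)

record Graph (V : Set) : Set where
  field
    adj     : V → V → Bool
    sym     : ∀ x y → adj x y ≡ adj y x
    irrefl  : ∀ x → adj x x ≡ false
open Graph public

Adj : Set → Set
Adj V = V → V → Bool

count : ∀ {n} → (Fin n → Bool) → ℕ
count {zero}  p = 0
count {suc n} p = (if p zero then 1 else 0) + count (p ∘ suc)

deg : ∀ {n} → Adj (Fin n) → Fin n → ℕ
deg A x = count (A x)

IsMinDegree : ∀ {n} → Graph (Fin n) → ℕ → Set
IsMinDegree G δ = (∀ x → δ ≤ deg (adj G) x) × (∃[ x ] deg (adj G) x ≡ δ)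

maxOf : ∀ {m} → (Fin m → ℕ) → ℕ
maxOf {zero}  f = 0
maxOf {suc m} f = f zero ⊔ maxOf (f ∘ suc)

data Reach {V : Set} (A : Adj V) : V → V → Set where
  here : ∀ {x} → Reach A x x
  step : ∀ {x y z} → A x y ≡ true → Reach A y z → Reach A x z

Iso : {V W : Set} → Adj V → Adj W → Set
Iso {V} {W} A B = Σ[ f ∈ V ↔ W ] (∀ a b → A a b ≡ B (Inverse.to f a) (Inverse.to f b))

isZero : ∀ {m} → Fin m → Bool
isZero zero    = true
isZero (suc _) = false

star : (j : ℕ) → Adj (Fin (suc j))
star j a b = isZero a xor isZero b

IsCycle : ∀ {r} → Adj (Fin r) → (l : ℕ) → (Fin (3 + l) → Fin r) → Set
IsCycle A l c =
  Injective _≡_ _≡_ c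
  × (∀ (i : Fin (2 + l)) → A (c (inject₁ i)) (c (suc i)) ≡ true)
  × A (c (fromℕ (2 + l))) (c zero) ≡ true

IsTree : ∀ {r} → Graph (Fin r) → Set
IsTree {r} R =
  1 ≤ r
  × (∀ x y → Reach (adj R) x y)
  × (∀ l (c : Fin (3 + l) → Fin r) → IsCycle (adj R) l c → ⊥)

module TreeFamily (k : ℕ) {r : ℕ} (R : Graph (Fin r)) where

  _==_ : Fin r → Fin r → Bool
  x == y = ⌊ x ≟ y ⌋

  leaf : Fin r → Bool
  leaf x = deg (adj R) x ≡ᵇ 1

  internal : Fin r → Bool
  internal x = not (leaf x)

  dInt : Fin r → ℕ
  dInt x = count (λ y → adj R x y ∧ internal y)

  nLeaf : Fin r → ℕ
  nLeaf x = count (λ y → adj R x y ∧ leaf y)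

  Admissible : Set
  Admissible = ∀ x → T (internal x) →
      (Σ[ s ∈ ℕ ] (dInt x ≡ 2 * s + 1 × s ≤ k))
    × (2 * nLeaf x + dInt x ≤ 2 * k + 1)

  -- number of new pendant edges attached at x in step (d):
  -- k - r - nLeaf x  when  dInt x = 2r+1 < 2k+1, and 0 otherwise
  pend : Fin r → ℕ
  pend x = if internal x ∧ (dInt x <ᵇ 2 * k + 1)
           then (k ∸ ((dInt x ∸ 1) / 2)) ∸ nLeaf x
           else 0

  -- subdivision vertices: one per edge {a,b} (a < b) of R - Leaf(R)
  subOK : Fin r → Fin r → Bool
  subOK a b = (toℕ a <ᵇ toℕ b) ∧ adj R a b ∧ internal a ∧ internal b

  Sub : Set
  Sub = Σ[ e ∈ Fin r × Fin r ] T (subOK (Data.Product.proj₁ e) (Data.Product.proj₂ e))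

  Pend : Set
  Pend = Σ[ x ∈ Fin r ] Fin (pend x)

  VT : Set
  VT = Fin r ⊎ (Sub ⊎ Pend)

  adjT : Adj VT
  adjT (inj₁ x) (inj₁ y) = adj R x y ∧ (leaf x ∨ leaf y)
  adjT (inj₁ x) (inj₂ (inj₁ ((a , b) , _))) = (x == a) ∨ (x == b)
  adjT (inj₁ x) (inj₂ (inj₂ (y , _))) = x == y
  adjT (inj₂ (inj₁ ((a , b) , _))) (inj₁ x) = (x == a) ∨ (x == b)
  adjT (inj₂ (inj₂ (y , _))) (inj₁ x) = x == y
  adjT (inj₂ _) (inj₂ _) = false

InTfam : (k : ℕ) → ∀ {p} → Adj (Fin p) → Set
InTfam k A =
  Σ[ r ∈ ℕ ] Σ[ R ∈ Graph (Fin r) ]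
    IsTree R × TreeFamily.Admissible k R × Iso A (TreeFamily.adjT k R)

InH : (k : ℕ) → ∀ {p} → Adj (Fin p) → Set
InH k A =
  (Σ[ j ∈ ℕ ] (1 ≤ j × j ≤ k × Iso A (star j))) ⊎ InTfam k A

comap : ∀ {p n} → Adj (Fin n) → (Fin p → Fin n) → Adj (Fin p)
comap A φ i j = A (φ i) (φ j)

-- G has a {K_{1,1},…,K_{1,k},𝒯(2k+1)}-factor: a spanning subgraph F of G
-- such that, for every vertex v, the component of F containing v
-- (the subgraph of F induced on the vertices reachable from v,
-- enumerated injectively by φ) is isomorphic to a member of the family.
HasFactor : (k : ℕ) → ∀ {n} → Graph (Fin n) → Set
HasFactor k {n} G =
  Σ[ F ∈ Graph (Fin n) ]
    (∀ x y → adj F x y ≡ true → adj G x y ≡ true)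
    × (∀ v → Σ[ p ∈ ℕ ] Σ[ φ ∈ (Fin p → Fin n) ]
         Injective _≡_ _≡_ φ
         × (∀ u → Reach (adj F) v u ⇔ (∃[ i ] φ i ≡ u))
         × InH k (comap (adj F) φ))

{-# OPTIONS --safe #-}

-- Call a packing a choice of centres in which every other vertex sends at most two units to adjacent
-- centres, each centre receiving between 1 and 2k+1 units.  Among the packings with the fewest missing
-- units take one with the fewest vertices split between two centres.
-- * Local exchanges show that a centre receiving from a split or deficient vertex is tight (receives
--   2k+1 units), and that all neighbours of a deficient vertex are tight centres.
-- * If some vertex u is deficient, let E be the set of vertices reached from u by alternating paths and
--   S = N(E).  Every vertex of E can be made deficient in its turn, so E is independent, S consists of
--   tight centres, and all their units come from E: (2k+1)|S| < 2|E|.  The degree condition gives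
--   2|E| ≤ (2k+1)|S| (a small independent set inside E has all its degrees bounded by |S|), so no unit is
--   missing.
-- * A cycle of split vertices could be rotated into unsplit ones, so the split vertices join the
--   centres into trees.  A centre without split vertices is the centre of a star with at most k leaves;
--   a tree of tight centres, where (2k+1) = 2·(pendants) + (split vertices) at every centre, is T_R for
--   R obtained by contracting each split vertex to an edge.
module Submission where

open import Defs
open import Data.Nat using (ℕ; _+_; _*_; _≤_)
open import Data.Nat.DivMod using (_/_)
open import Data.Fin using (Fin)
open import Data.Bool using (false)
open import Function using (_∘_)
open import Function.Definitions using (Injective)
open import Relation.Binary.PropositionalEquality using (_≡_)

open import Data.Bool using (Bool; true; _∧_; _∨_; not; if_then_else_; T)
open import Data.Bool.Properties using (∨-comm; T-irrelevant; not-involutive)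
open import Data.Empty using (⊥; ⊥-elim)
open import Data.Fin using (zero; suc; _≟_; inject₁; inject≤; fromℕ; toℕ)
open import Data.Fin.Properties using (any?; all?; injective⇒≤; suc-injective; inject≤-injective; toℕ-inject₁; toℕ-injective; fromℕ≢inject₁)
open import Data.Fin.Relation.Unary.Top using (view; ‵fromℕ; ‵inject₁)
open import Data.Nat using (zero; suc; _∸_; _<_; z≤n; s≤s; _≤?_)
open import Data.Nat.DivMod using (m/n*n≤m; m*n/n≡m)
open import Data.Nat.Properties hiding (suc-injective; _≟_)
open import Data.Product using (Σ-syntax; ∃; ∃-syntax; _×_; _,_; proj₁; proj₂)
open import Data.Sum using (_⊎_; inj₁; inj₂)
open import Data.Vec using (Vec; []; _∷_; lookup; tabulate)
open import Data.Vec.Properties using (lookup∘tabulate)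
open import Function using (_⇔_; mk⇔; Equivalence; _↔_; Inverse; mk↔ₛ′)
open import Function.Construct.Identity using (↔-id)
open import Relation.Binary.Definitions using (tri<; tri≈; tri>)
open import Relation.Binary.PropositionalEquality using (_≢_; refl; trans; cong; cong₂; subst; subst₂; module ≡-Reasoning) renaming (sym to ≡-sym)
open import Relation.Nullary using (¬_; Dec; yes; no; contradiction)
open import Relation.Nullary.Decidable using (⌊_⌋; map′; _×-dec_; _→-dec_; _⊎-dec_; ¬?)
open import Relation.Unary using (Decidable)
open import Algebra.Properties.CommutativeMonoid.Sum +-0-commutativeMonoid using (sum; sum-cong-≗; ∑-distrib-+; ∑-comm)

-- The ratio k + 1/2 is not an integer, hence the count in half vertices: each vertex owns two units
-- and a centre takes up to 2k+1 of them. The odd capacity is where the family comes from: unsplit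
-- vertices alone cannot fill a centre, and the parity of the number of split vertices at a full
-- centre is condition (a) on R. The obstacle is that the centres are not given beforehand. With
-- fixed centres this would be a bipartite flow problem; here an exchange may have to create a
-- centre or reverse a small star or path, and it must neither strand the senders of a former centre
-- nor leave a centre empty. Such changes are needed only locally, to show that a deficient vertex
-- sees nothing but full centres; along alternating paths the centres and all loads stay fixed.
-- Those paths can create split vertices, so minimality of the second count does not persist along
-- them. Its local consequence `Good` does, and suffices. Finally, R keeps every pendant vertex as a
-- leaf, so that (b) holds with equality and step (d) attaches nothing.

private variable
  n m : ℕ

-- Counting and reachability

true≢false : ∀ {b} → b ≡ true → b ≡ false → ⊥
true≢false refl ()

¬true⇒false : ∀ {b} → ¬ (b ≡ true) → b ≡ false
¬true⇒false {true}  h = contradiction refl h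
¬true⇒false {false} h = refl

bool-ext : ∀ {a b} → (a ≡ true → b ≡ true) → (b ≡ true → a ≡ true) → a ≡ b
bool-ext {true}  {b}     f g = ≡-sym (f refl)
bool-ext {false} {true}  f g = g refl
bool-ext {false} {false} f g = refl

∧-true : ∀ {a b} → a ∧ b ≡ true → a ≡ true × b ≡ true
∧-true {true} e = refl , e

∧-intro : ∀ {a b} → a ≡ true → b ≡ true → a ∧ b ≡ true
∧-intro refl e = e

∨-true : ∀ {a b} → a ∨ b ≡ true → a ≡ true ⊎ b ≡ true
∨-true {true}  e = inj₁ refl
∨-true {false} e = inj₂ e

∨-introˡ : ∀ {a b} → a ≡ true → a ∨ b ≡ true
∨-introˡ refl = refl

∨-introʳ : ∀ {a b} → b ≡ true → a ∨ b ≡ true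
∨-introʳ {true}  e = refl
∨-introʳ {false} e = e

⌊⌋-true : ∀ {A : Set} (d : Dec A) → ⌊ d ⌋ ≡ true → A
⌊⌋-true (yes a) _ = a

⌊⌋-intro : ∀ {A : Set} (d : Dec A) → A → ⌊ d ⌋ ≡ true
⌊⌋-intro (yes _) a = refl
⌊⌋-intro (no ¬a) a = contradiction a ¬a

ind : Bool → ℕ
ind b = if b then 1 else 0

ind≤1 : ∀ b → ind b ≤ 1
ind≤1 true  = ≤-refl
ind≤1 false = z≤n

count-sum : (p : Fin n → Bool) → count p ≡ sum (ind ∘ p)
count-sum {zero}  p = refl
count-sum {suc n} p = cong (ind (p zero) +_) (count-sum (p ∘ suc))

sum-mono : {f g : Fin n → ℕ} → (∀ i → f i ≤ g i) → sum f ≤ sum g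
sum-mono {zero}  h = z≤n
sum-mono {suc n} h = +-mono-≤ (h zero) (sum-mono (h ∘ suc))

sum-strict : {f g : Fin n → ℕ} → (∀ i → f i ≤ g i) → ∀ i → f i < g i → sum f < sum g
sum-strict h zero    lt = +-mono-<-≤ lt (sum-mono (h ∘ suc))
sum-strict h (suc i) lt = +-mono-≤-< (h zero) (sum-strict (h ∘ suc) i lt)

sum-zero : {f : Fin n → ℕ} → (∀ i → f i ≡ 0) → sum f ≡ 0
sum-zero {zero}  h = refl
sum-zero {suc n} h = cong₂ _+_ (h zero) (sum-zero (h ∘ suc))

sum-*ˡ : ∀ c (f : Fin n → ℕ) → sum (λ i → c * f i) ≡ c * sum f
sum-*ˡ {zero}  c f = ≡-sym (*-zeroʳ c)
sum-*ˡ {suc n} c f = trans (cong (c * f zero +_) (sum-*ˡ c (f ∘ suc))) (≡-sym (*-distribˡ-+ c (f zero) _))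

-- The exchanged terms stand on opposite sides so that no truncated subtraction occurs. All
-- bookkeeping of loads, missing units and splits under an exchange inherits this additive form.
sum-replace : {f g : Fin n → ℕ} (x : Fin n) → (∀ i → i ≢ x → f i ≡ g i)
  → sum f + g x ≡ sum g + f x
sum-replace {suc n} {f} {g} zero h = begin
  (f zero + sum (f ∘ suc)) + g zero ≡⟨ +-comm _ (g zero) ⟩
  g zero + (f zero + sum (f ∘ suc)) ≡⟨ cong (λ t → g zero + (f zero + t)) (sum-cong-≗ (λ i → h (suc i) λ ())) ⟩
  g zero + (f zero + sum (g ∘ suc)) ≡⟨ cong (g zero +_) (+-comm (f zero) _) ⟩
  g zero + (sum (g ∘ suc) + f zero) ≡⟨ +-assoc (g zero) _ _ ⟨
  (g zero + sum (g ∘ suc)) + f zero ∎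
  where open ≡-Reasoning
sum-replace {suc n} {f} {g} (suc x) h = begin
  (f zero + sum (f ∘ suc)) + g (suc x) ≡⟨ +-assoc (f zero) _ _ ⟩
  f zero + (sum (f ∘ suc) + g (suc x)) ≡⟨ cong₂ _+_ (h zero λ ()) (sum-replace x (λ i ne → h (suc i) (ne ∘ suc-injective))) ⟩
  g zero + (sum (g ∘ suc) + f (suc x)) ≡⟨ +-assoc (g zero) _ _ ⟨
  (g zero + sum (g ∘ suc)) + f (suc x) ∎
  where open ≡-Reasoning

term≤sum : (f : Fin n → ℕ) → ∀ i → f i ≤ sum f
term≤sum f zero    = m≤m+n (f zero) _
term≤sum f (suc i) = ≤-trans (term≤sum (f ∘ suc) i) (m≤n+m _ (f zero))

two-terms≤sum : (f : Fin n → ℕ) → ∀ {i j} → i ≢ j → f i + f j ≤ sum f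
two-terms≤sum f {zero}  {zero}  ne = contradiction refl ne
two-terms≤sum f {zero}  {suc j} ne = +-monoʳ-≤ (f zero) (term≤sum (f ∘ suc) j)
two-terms≤sum f {suc i} {zero}  ne =
  subst (_≤ sum f) (+-comm (f zero) _) (+-monoʳ-≤ (f zero) (term≤sum (f ∘ suc) i))
two-terms≤sum f {suc i} {suc j} ne =
  ≤-trans (two-terms≤sum (f ∘ suc) (λ e → ne (cong suc e))) (m≤n+m _ (f zero))

sum-pos : (f : Fin n → ℕ) → 1 ≤ sum f → ∃[ i ] 1 ≤ f i
sum-pos {suc n} f le with 1 ≤? f zero
... | yes p = zero , p
... | no ¬p with f zero | n<1⇒n≡0 (≰⇒> ¬p)
...   | _ | refl = let i , q = sum-pos (f ∘ suc) le in suc i , q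

abstract
  enumerate : (p : Fin n → Bool) → Σ[ φ ∈ (Fin (count p) → Fin n) ]
    Injective _≡_ _≡_ φ × (∀ i → p (φ i) ≡ true) × (∀ u → p u ≡ true → ∃[ i ] φ i ≡ u)
  enumerate {zero} p = (λ ()) , (λ {}) , (λ ()) , (λ ())
  enumerate {suc n} p with p zero in eq | enumerate (p ∘ suc)
  ... | true | φ , inj , sat , sur = ψ , ψ-inj , ψ-sat , ψ-sur
    where
    ψ : Fin (suc (count (p ∘ suc))) → Fin (suc n)
    ψ zero    = zero
    ψ (suc i) = suc (φ i)
    ψ-inj : Injective _≡_ _≡_ ψ
    ψ-inj {zero}  {zero}  e = refl
    ψ-inj {suc i} {suc j} e = cong suc (inj (suc-injective e))
    ψ-sat : ∀ i → p (ψ i) ≡ true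
    ψ-sat zero    = eq
    ψ-sat (suc i) = sat i
    ψ-sur : ∀ u → p u ≡ true → ∃[ i ] ψ i ≡ u
    ψ-sur zero    h = zero , refl
    ψ-sur (suc u) h = let i , e = sur u h in suc i , cong suc e
  ... | false | φ , inj , sat , sur =
    suc ∘ φ , inj ∘ suc-injective , sat , λ where
      zero    h → ⊥-elim (true≢false h eq)
      (suc u) h → let i , e = sur u h in i , cong suc e

-- The map may depend on the proof that `p` holds, because the images used later are witnesses
-- extracted from such proofs.
count-inject : (p : Fin n → Bool) (q : Fin m → Bool) (f : ∀ i → p i ≡ true → Fin m)
  → (∀ i h → q (f i h) ≡ true)
  → (∀ i h i′ h′ → f i h ≡ f i′ h′ → i ≡ i′)
  → count p ≤ count q
count-inject p q f f-sat f-inj =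
  injective⇒≤ {f = λ i → proj₁ (pre i)} λ {i} {j} e →
    φ-inj (f-inj _ _ _ _ (trans (≡-sym (proj₂ (pre i))) (trans (cong ψ e) (proj₂ (pre j)))))
  where
  φ     = proj₁ (enumerate p)
  φ-inj = proj₁ (proj₂ (enumerate p))
  φ-sat = proj₁ (proj₂ (proj₂ (enumerate p)))
  ψ     = proj₁ (enumerate q)
  ψ-sur = proj₂ (proj₂ (proj₂ (enumerate q)))
  pre : ∀ i → ∃[ j ] ψ j ≡ f (φ i) (φ-sat i)
  pre i = ψ-sur _ (f-sat _ (φ-sat i))

count-mono : (p q : Fin n → Bool) → (∀ i → p i ≡ true → q i ≡ true) → count p ≤ count q
count-mono p q h = count-inject p q (λ i _ → i) h (λ _ _ _ _ e → e)

count-cong : {p q : Fin n → Bool} → (∀ i → p i ≡ q i) → count p ≡ count q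
count-cong {zero}  h = refl
count-cong {suc n} h = cong₂ (λ b c → ind b + c) (h zero) (count-cong (h ∘ suc))

count-strict : (p q : Fin n → Bool) → (∀ i → p i ≡ true → q i ≡ true)
  → ∀ x → p x ≡ false → q x ≡ true → count p < count q
count-strict p q h x px qx =
  subst₂ _<_ (≡-sym (count-sum p)) (≡-sym (count-sum q)) (sum-strict pointwise x at-x)
  where
  pointwise : ∀ i → ind (p i) ≤ ind (q i)
  pointwise i with p i | h i
  ... | false | _ = z≤n
  ... | true  | e rewrite e refl = ≤-refl
  at-x : ind (p x) < ind (q x)
  at-x rewrite px | qx = s≤s z≤n

count≤n : (p : Fin n → Bool) → count p ≤ n
count≤n {zero}  p = z≤n
count≤n {suc n} p = +-mono-≤ (ind≤1 (p zero)) (count≤n (p ∘ suc))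

count-split : (p q : Fin n → Bool) → count p ≡ count (λ i → p i ∧ q i) + count (λ i → p i ∧ not (q i))
count-split p q = begin
  count p                                     ≡⟨ count-sum p ⟩
  sum (ind ∘ p)                               ≡⟨ sum-cong-≗ (λ i → pointwise (p i) (q i)) ⟩
  sum (λ i → ind (p i ∧ q i) + ind (p i ∧ not (q i))) ≡⟨ ∑-distrib-+ (λ i → ind (p i ∧ q i)) _ ⟩
  _                                           ≡⟨ cong₂ _+_ (count-sum (λ i → p i ∧ q i)) (count-sum (λ i → p i ∧ not (q i))) ⟨
  _ ∎
  where
  open ≡-Reasoning
  pointwise : ∀ a b → ind a ≡ ind (a ∧ b) + ind (a ∧ not b)
  pointwise true  true  = refl
  pointwise true  false = refl
  pointwise false _     = refl

count-disjoint : (p q : Fin n → Bool) → (∀ i → p i ≡ true → q i ≡ true → ⊥) → count p + count q ≤ n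
count-disjoint {n} p q dis = begin
  count p + count q                        ≡⟨ +-comm (count p) _ ⟩
  count q + count p                        ≤⟨ +-monoʳ-≤ (count q) (count-mono p _ λ i h → cong not (¬true⇒false (dis i h))) ⟩
  count q + count (λ i → true ∧ not (q i)) ≡⟨ count-split {n} (λ _ → true) q ⟨
  count {n} (λ _ → true)                   ≤⟨ count≤n (λ _ → true) ⟩
  _ ∎
  where open ≤-Reasoning

count-one : (p : Fin n → Bool) → ∀ x → p x ≡ true → (∀ y → p y ≡ true → y ≡ x) → count p ≡ 1
count-one {n} p x px uniq = ≤-antisym
  (count-inject p (λ (_ : Fin 1) → true) (λ _ _ → zero) (λ _ _ → refl)
    (λ i h i′ h′ _ → trans (uniq i h) (≡-sym (uniq i′ h′))))
  (count-inject (λ (_ : Fin 1) → true) p (λ _ _ → x) (λ _ _ → px) (λ where zero _ zero _ _ → refl))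

module _ {V : Set} {A : Adj V} where

  Reach-trans : ∀ {x y z} → Reach A x y → Reach A y z → Reach A x z
  Reach-trans here       q = q
  Reach-trans (step e p) q = step e (Reach-trans p q)

  Reach-sym : (∀ x y → A x y ≡ A y x) → ∀ {x y} → Reach A x y → Reach A y x
  Reach-sym s here       = here
  Reach-sym s (step e p) = Reach-trans (Reach-sym s p) (step (trans (s _ _) e) here)

  Reach-closed : (P : V → Set) → (∀ {x y} → P x → A x y ≡ true → P y) → ∀ {x y} → Reach A x y → P x → P y
  Reach-closed P cl here       px = px
  Reach-closed P cl (step e p) px = Reach-closed P cl p (cl px e)

module Closure (A : Adj (Fin n)) (v : Fin n) where

  private
    -- The fuel bounds the number of vertices still outside `S`. Each round adds one vertex, so when
    -- the fuel is spent `S` is everything and no edge can leave it.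
    grow : ∀ fuel (S : Fin n → Bool) → n ≤ fuel + count S → S v ≡ true
      → (∀ u → S u ≡ true → Reach A v u)
      → Σ[ S′ ∈ (Fin n → Bool) ] (∀ u → S′ u ≡ true ⇔ Reach A v u)
    grow fuel S le Sv sound
      with any? (λ x → any? (λ y → (S x Data.Bool.≟ true) ×-dec (A x y Data.Bool.≟ true) ×-dec (S y Data.Bool.≟ false)))
    ... | no ¬e = S , λ u → mk⇔ (sound u) λ r → Reach-closed (λ w → S w ≡ true) closed r Sv
      where
      closed : ∀ {x y} → S x ≡ true → A x y ≡ true → S y ≡ true
      closed {x} {y} sx axy with S y in eq
      ... | true  = refl
      ... | false = contradiction (x , y , sx , axy , eq) ¬e
    grow zero S le Sv sound | yes (x , y , sx , axy , sy) =
      ⊥-elim (<-irrefl refl (≤-<-trans le (<-≤-trans (count-strict S (λ _ → true) (λ _ _ → refl) y sy refl) (count≤n (λ _ → true)))))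
    grow (suc fuel) S le Sv sound | yes (x , y , sx , axy , sy) =
      grow fuel S′ le′ (∨-introˡ Sv) sound′
      where
      S′ : Fin n → Bool
      S′ u = S u ∨ ⌊ u ≟ y ⌋
      le′ : n ≤ fuel + count S′
      le′ = ≤-trans le (subst (_≤ fuel + count S′) (+-suc fuel (count S))
              (+-monoʳ-≤ fuel (count-strict S S′ (λ _ → ∨-introˡ) y sy (∨-introʳ (⌊⌋-intro (y ≟ y) refl)))))
      sound′ : ∀ u → S′ u ≡ true → Reach A v u
      sound′ u h with ∨-true {S u} h
      ... | inj₁ su = sound u su
      ... | inj₂ e with refl ← ⌊⌋-true (u ≟ y) e = Reach-trans (sound x sx) (step axy here)

  abstract
    closure : Σ[ S ∈ (Fin n → Bool) ] (∀ u → S u ≡ true ⇔ Reach A v u)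
    closure = grow n (λ u → ⌊ u ≟ v ⌋) (m≤m+n n _) (⌊⌋-intro (v ≟ v) refl)
      (λ u h → subst (Reach A v) (≡-sym (⌊⌋-true (u ≟ v) h)) here)

  reachable : Fin n → Bool
  reachable = proj₁ closure

  reachable⇔ : ∀ u → reachable u ≡ true ⇔ Reach A v u
  reachable⇔ = proj₂ closure

-- Packings and exchanges

-- Finiteness in the one form that minimisation needs. Packings are searched as vectors, since
-- functions could be matched only up to pointwise equality; `valid-cong` carries validity across
-- that gap.
Searchable : Set → Set₁
Searchable A = ∀ {P : A → Set} → Decidable P → Dec (∃ P)

search-Vec : ∀ {A} → Searchable A → ∀ m → Searchable (Vec A m)
search-Vec S zero    P? = map′ ([] ,_) (λ { ([] , p) → p }) (P? [])
search-Vec S (suc m) P? =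
  map′ (λ (a , v , p) → a ∷ v , p) (λ { (a ∷ v , p) → a , v , p })
    (S λ a → search-Vec S m λ v → P? (a ∷ v))

minimise : ∀ {A} → Searchable A → {P : A → Set} → Decidable P → (cost : A → ℕ)
  → ∃ P → Σ[ a ∈ A ] P a × (∀ b → P b → cost a ≤ cost b)
minimise {A} S {P} P? cost (a , p) = go (cost a) a p ≤-refl
  where
  go : ∀ fuel a → P a → cost a ≤ fuel → Σ[ a ∈ A ] P a × (∀ b → P b → cost a ≤ cost b)
  go fuel a p le with S (λ b → P? b ×-dec (suc (cost b) ≤? cost a))
  ... | no none = a , p , λ b pb → ≮⇒≥ λ lt → none (b , pb , lt)
  go zero       a p le | yes (b , pb , lt) = contradiction (≤-trans lt le) λ ()
  go (suc fuel) a p le | yes (b , pb , lt) = go fuel b pb (≤-pred (≤-trans lt le))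

-- free, one and two send 0, 1 and 2 units; two a a sends both to the same centre.
data Cell (n : ℕ) : Set where
  ctr free : Cell n
  one      : Fin n → Cell n
  two      : Fin n → Fin n → Cell n

search-Cell : Searchable (Cell n)
search-Cell P? with P? ctr | P? free | any? (λ a → P? (one a)) | any? (λ a → any? λ b → P? (two a b))
... | yes p | _     | _           | _               = yes (ctr , p)
... | no _  | yes p | _           | _               = yes (free , p)
... | no _  | no _  | yes (a , p) | _               = yes (one a , p)
... | no _  | no _  | no _        | yes (a , b , p) = yes (two a b , p)
... | no c  | no f  | no o        | no t            = no λ where
  (ctr , p)     → c p
  (free , p)    → f p
  (one a , p)   → o (a , p)
  (two a b , p) → t (a , b , p)

ctr? : (c : Cell n) → Dec (c ≡ ctr)
ctr? ctr       = yes refl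
ctr? free      = no λ ()
ctr? (one _)   = no λ ()
ctr? (two _ _) = no λ ()

δ : Fin n → Fin n → ℕ
δ a y = ind ⌊ a ≟ y ⌋

δ-refl : (a : Fin n) → δ a a ≡ 1
δ-refl a with a ≟ a
... | yes _ = refl
... | no ¬p = contradiction refl ¬p

δ-≢ : {a y : Fin n} → a ≢ y → δ a y ≡ 0
δ-≢ {a = a} {y} ne with a ≟ y
... | yes p = contradiction p ne
... | no _  = refl

δ-≡ : {a y : Fin n} → 1 ≤ δ a y → a ≡ y
δ-≡ {a = a} {y} le with a ≟ y
... | yes p = p

δ≤1 : (a y : Fin n) → δ a y ≤ 1
δ≤1 a y = ind≤1 ⌊ a ≟ y ⌋

sum-δ : (a : Fin n) → sum (δ a) ≡ 1
sum-δ {n} a = begin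
  sum (δ a)     ≡⟨ +-identityʳ _ ⟨
  sum (δ a) + 0 ≡⟨ sum-replace {n} {δ a} {λ _ → 0} a (λ i ne → δ-≢ (λ e → ne (≡-sym e))) ⟩
  sum {n = n} (λ _ → 0) + δ a a ≡⟨ cong₂ _+_ (sum-zero {n} {λ _ → 0} λ _ → refl) (δ-refl a) ⟩
  0 + 1         ∎
  where open ≡-Reasoning

mult : Cell n → Fin n → ℕ
mult ctr       y = 0
mult free      y = 0
mult (one a)   y = δ a y
mult (two a b) y = δ a y + δ b y

miss : Cell n → ℕ
miss ctr       = 0
miss free      = 2
miss (one _)   = 1
miss (two _ _) = 0

split : Cell n → ℕ
split (two a b) = 1 ∸ δ a b
split _         = 0

split-≢ : {a b : Fin n} → a ≢ b → split (two a b) ≡ 1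
split-≢ ne rewrite δ-≢ ne = refl

split-same : (a : Fin n) → split (two a a) ≡ 0
split-same a rewrite δ-refl a = refl

add : Cell n → Fin n → Cell n
add ctr       y = ctr
add free      y = one y
add (one a)   y = two a y
add (two a b) y = two a b

-- If the first unit of `two a b` does not go to `y`, the second is dropped untested; the lemmas on
-- units assume that `y` does receive something from the cell.
remove : Cell n → Fin n → Cell n
remove ctr       y = ctr
remove free      y = free
remove (one a)   y = free
remove (two a b) y = if ⌊ a ≟ y ⌋ then one b else one a

miss⇒≢ctr : {c : Cell n} → 1 ≤ miss c → c ≢ ctr
miss⇒≢ctr () refl

sends⇒≢ctr : {c : Cell n} {y : Fin n} → 1 ≤ mult c y → c ≢ ctr
sends⇒≢ctr () refl

mult-add : (c : Cell n) (y : Fin n) → 1 ≤ miss c → ∀ w → mult (add c y) w ≡ mult c w + δ y w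
mult-add free    y le w = refl
mult-add (one a) y le w = refl

miss-add : (c : Cell n) (y : Fin n) → 1 ≤ miss c → suc (miss (add c y)) ≡ miss c
miss-add free    y le = refl
miss-add (one a) y le = refl

add≢ctr : (c : Cell n) (y : Fin n) → 1 ≤ miss c → add c y ≢ ctr
add≢ctr free    y le ()
add≢ctr (one a) y le ()

remove≢ctr : (c : Cell n) (y : Fin n) → c ≢ ctr → remove c y ≢ ctr
remove≢ctr ctr       y ne _ = ne refl
remove≢ctr (two a b) y ne e with a ≟ y
remove≢ctr (two a b) y ne () | yes _
remove≢ctr (two a b) y ne () | no _

mult-remove : (c : Cell n) (y : Fin n) → 1 ≤ mult c y → ∀ w → mult (remove c y) w + δ y w ≡ mult c w
mult-remove (one a) y le w with refl ← δ-≡ {a = a} {y} le = refl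
mult-remove (two a b) y le w with a ≟ y
... | yes refl = +-comm (δ b w) _
... | no ne with refl ← δ-≡ {a = b} {y} le = refl

miss-remove : (c : Cell n) (y : Fin n) → 1 ≤ mult c y → miss (remove c y) ≡ suc (miss c)
miss-remove (one a) y le = refl
miss-remove (two a b) y le with a ≟ y
... | yes _ = refl
... | no _  = refl

split-remove : (c : Cell n) (y : Fin n) → split (remove c y) ≡ 0
split-remove ctr       y = refl
split-remove free      y = refl
split-remove (one a)   y = refl
split-remove (two a b) y with a ≟ y
... | yes _ = refl
... | no _  = refl

units : Cell n → ℕ
units ctr       = 0
units free      = 0
units (one _)   = 1
units (two _ _) = 2

sum-mult : (c : Cell n) → sum (mult c) ≡ units c
sum-mult {n} ctr       = sum-zero {n} {λ _ → 0} λ _ → refl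
sum-mult {n} free      = sum-zero {n} {λ _ → 0} λ _ → refl
sum-mult (one a)   = sum-δ a
sum-mult (two a b) = trans (∑-distrib-+ (δ a) (δ b)) (cong₂ _+_ (sum-δ a) (sum-δ b))

units≤2 : (c : Cell n) → units c ≤ 2
units≤2 ctr       = z≤n
units≤2 free      = z≤n
units≤2 (one _)   = s≤s z≤n
units≤2 (two _ _) = ≤-refl

miss⇒units<2 : (c : Cell n) → 1 ≤ miss c → units c < 2
miss⇒units<2 free    le = s≤s z≤n
miss⇒units<2 (one _) le = ≤-refl

mult≤units : (c : Cell n) (y : Fin n) → mult c y ≤ units c
mult≤units ctr       y = z≤n
mult≤units free      y = z≤n
mult≤units (one a)   y = δ≤1 a y
mult≤units (two a b) y = +-mono-≤ (δ≤1 a y) (δ≤1 b y)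

mult-two-same : (a : Fin n) → mult (two a a) a ≡ 2
mult-two-same a = cong₂ _+_ (δ-refl a) (δ-refl a)

mult-two-≢ : {a b y : Fin n} → a ≢ y → b ≢ y → mult (two a b) y ≡ 0
mult-two-≢ p q = cong₂ _+_ (δ-≢ p) (δ-≢ q)

sends-two : {a b y : Fin n} → 1 ≤ mult (two a b) y → a ≡ y ⊎ b ≡ y
sends-two {a = a} {b} {y} le with a ≟ y
... | yes e = inj₁ e
... | no _  = inj₂ (δ-≡ le)

sends-two-same : {a y : Fin n} → 1 ≤ mult (two a a) y → a ≡ y
sends-two-same le with sends-two le
... | inj₁ e = e
... | inj₂ e = e

sends-fst : (a b : Fin n) → 1 ≤ mult (two a b) a
sends-fst a b rewrite δ-refl a = s≤s z≤n

sends-snd : (a b : Fin n) → 1 ≤ mult (two a b) b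
sends-snd a b rewrite δ-refl b = m≤n+m 1 (δ a b)

State : ℕ → Set
State n = Fin n → Cell n

load : State n → Fin n → ℕ
load s y = sum (λ x → mult (s x) y)

missing : State n → ℕ
missing s = sum (miss ∘ s)

splits : State n → ℕ
splits s = sum (split ∘ s)

upd : State n → Fin n → Cell n → State n
upd s x c y = if ⌊ x ≟ y ⌋ then c else s y

upd-same : (s : State n) (x : Fin n) (c : Cell n) → upd s x c x ≡ c
upd-same s x c with x ≟ x
... | yes _ = refl
... | no ¬p = contradiction refl ¬p

upd-other : (s : State n) (x : Fin n) (c : Cell n) {y : Fin n} → y ≢ x → upd s x c y ≡ s y
upd-other s x c {y} ne with x ≟ y
... | yes refl = contradiction refl ne
... | no _     = refl

sum-upd : (f : Cell n → ℕ) (s : State n) (x : Fin n) (c : Cell n)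
  → sum (f ∘ upd s x c) + f (s x) ≡ sum (f ∘ s) + f c
sum-upd f s x c = trans (sum-replace x λ i ne → cong f (upd-other s x c ne))
  (cong (λ c → sum (f ∘ s) + f c) (upd-same s x c))

load-upd : (s : State n) (x : Fin n) (c : Cell n) (y : Fin n)
  → load (upd s x c) y + mult (s x) y ≡ load s y + mult c y
load-upd s x c y = sum-upd (λ c → mult c y) s x c

module Packing (k : ℕ) (2≤k : 2 ≤ k) {n : ℕ} (G : Graph (Fin n)) where

  cap : ℕ
  cap = 2 * k + 1

  -- The form in which k ≥ 2 is mostly used: four units fit at a newly made centre, and a full
  -- centre may lose three units and still not be empty.
  5≤cap : 5 ≤ cap
  5≤cap = +-monoˡ-≤ 1 (*-monoʳ-≤ 2 2≤k)

  -- `load-lo` forbids a centre that would be an isolated vertex of the factor. Deficient vertices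
  -- are permitted and only counted, so a valid packing always exists: all vertices free.
  record Valid (s : State n) : Set where
    field
      sends-adj : ∀ x y → 1 ≤ mult (s x) y → adj G x y ≡ true
      sends-ctr : ∀ x y → 1 ≤ mult (s x) y → s y ≡ ctr
      load-lo   : ∀ y → s y ≡ ctr → 1 ≤ load s y
      load-hi   : ∀ y → s y ≡ ctr → load s y ≤ cap

  open Valid

  valid? : ∀ s → Dec (Valid s)
  valid? s = map′
    (λ (a , b , c , d) → record { sends-adj = a ; sends-ctr = b ; load-lo = c ; load-hi = d })
    (λ v → sends-adj v , sends-ctr v , load-lo v , load-hi v)
    (all? (λ x → all? λ y → (1 ≤? mult (s x) y) →-dec (adj G x y Data.Bool.≟ true)) ×-dec
     all? (λ x → all? λ y → (1 ≤? mult (s x) y) →-dec ctr? (s y)) ×-dec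
     all? (λ y → ctr? (s y) →-dec (1 ≤? load s y)) ×-dec
     all? (λ y → ctr? (s y) →-dec (load s y ≤? cap)))

  valid-cong : ∀ {s s′} → (∀ x → s x ≡ s′ x) → Valid s → Valid s′
  valid-cong {s} {s′} eq v = record
    { sends-adj = λ x y le → sends-adj v x y (subst (λ c → 1 ≤ mult c y) (≡-sym (eq x)) le)
    ; sends-ctr = λ x y le → trans (≡-sym (eq y)) (sends-ctr v x y (subst (λ c → 1 ≤ mult c y) (≡-sym (eq x)) le))
    ; load-lo   = λ y e → subst (1 ≤_) (load-eq y) (load-lo v y (trans (eq y) e))
    ; load-hi   = λ y e → subst (_≤ cap) (load-eq y) (load-hi v y (trans (eq y) e))
    }
    where
    load-eq : ∀ y → load s y ≡ load s′ y
    load-eq y = sum-cong-≗ (λ x → cong (λ c → mult c y) (eq x))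

  load-noncentre : ∀ {s} → Valid s → ∀ {y} → s y ≢ ctr → load s y ≡ 0
  load-noncentre {s} v {y} ne = n<1⇒n≡0 (≰⇒> λ le → let x , h = sum-pos (λ x → mult (s x) y) le in ne (sends-ctr v x y h))

  mult-noncentre : ∀ {s} → Valid s → ∀ {y} → s y ≢ ctr → ∀ x → mult (s x) y ≡ 0
  mult-noncentre {s} v {y} ne x = n<1⇒n≡0 (≰⇒> λ le → ne (sends-ctr v x y le))

  -- For exchanges that preserve the set of centres: then the units of all other vertices remain
  -- legal, and only the new cell and the loads need checking.
  upd-valid : ∀ {s} → Valid s → ∀ x c → s x ≢ ctr → c ≢ ctr
    → (∀ y → 1 ≤ mult c y → adj G x y ≡ true × s y ≡ ctr)
    → (∀ y → s y ≡ ctr → 1 ≤ load (upd s x c) y × load (upd s x c) y ≤ cap)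
    → Valid (upd s x c)
  upd-valid {s} v x c sx≢ c≢ ok bounds = record
    { sends-adj = λ w y le → sa w y (w ≟ x) le
    ; sends-ctr = λ w y le → keep y (sc w y (w ≟ x) le)
    ; load-lo   = λ y e → proj₁ (bounds y (back y e))
    ; load-hi   = λ y e → proj₂ (bounds y (back y e))
    }
    where
    sa : ∀ w y → Dec (w ≡ x) → 1 ≤ mult (upd s x c w) y → adj G w y ≡ true
    sa w y (yes refl) le rewrite upd-same s w c = proj₁ (ok y le)
    sa w y (no ne)    le rewrite upd-other s x c ne = sends-adj v w y le
    sc : ∀ w y → Dec (w ≡ x) → 1 ≤ mult (upd s x c w) y → s y ≡ ctr
    sc w y (yes refl) le rewrite upd-same s w c = proj₂ (ok y le)
    sc w y (no ne)    le rewrite upd-other s x c ne = sends-ctr v w y le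
    keep : ∀ y → s y ≡ ctr → upd s x c y ≡ ctr
    keep y e = trans (upd-other s x c λ { refl → sx≢ e }) e
    back : ∀ y → upd s x c y ≡ ctr → s y ≡ ctr
    back y e with y ≟ x
    ... | yes refl = contradiction (trans (≡-sym (upd-same s x c)) e) c≢
    ... | no ne    = trans (≡-sym (upd-other s x c ne)) e

  addS remS : State n → Fin n → Fin n → State n
  addS s x y = upd s x (add (s x) y)
  remS s x y = upd s x (remove (s x) y)

  add-load : ∀ s x y → 1 ≤ miss (s x) → ∀ w → load (addS s x y) w ≡ load s w + δ y w
  add-load s x y def w = +-cancelʳ-≡ (mult (s x) w) _ _ (begin
    load (addS s x y) w + mult (s x) w ≡⟨ load-upd s x (add (s x) y) w ⟩
    load s w + mult (add (s x) y) w    ≡⟨ cong (load s w +_) (trans (mult-add (s x) y def w) (+-comm _ (δ y w))) ⟩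
    load s w + (δ y w + mult (s x) w)  ≡⟨ +-assoc (load s w) _ _ ⟨
    load s w + δ y w + mult (s x) w    ∎)
    where open ≡-Reasoning

  rem-load : ∀ s x y → 1 ≤ mult (s x) y → ∀ w → load (remS s x y) w + δ y w ≡ load s w
  rem-load s x y le w = +-cancelʳ-≡ (mult (remove (s x) y) w) _ _ (begin
    load (remS s x y) w + δ y w + mult (remove (s x) y) w   ≡⟨ +-assoc (load (remS s x y) w) _ _ ⟩
    load (remS s x y) w + (δ y w + mult (remove (s x) y) w) ≡⟨ cong (load (remS s x y) w +_) (trans (+-comm (δ y w) _) (mult-remove (s x) y le w)) ⟩
    load (remS s x y) w + mult (s x) w                      ≡⟨ load-upd s x (remove (s x) y) w ⟩
    load s w + mult (remove (s x) y) w                      ∎)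
    where open ≡-Reasoning

  add-missing : ∀ s x y → 1 ≤ miss (s x) → suc (missing (addS s x y)) ≡ missing s
  add-missing s x y def = +-cancelʳ-≡ (miss (add (s x) y)) _ _ (begin
    suc (missing (addS s x y)) + miss (add (s x) y) ≡⟨ +-suc (missing (addS s x y)) _ ⟨
    missing (addS s x y) + suc (miss (add (s x) y)) ≡⟨ cong (missing (addS s x y) +_) (miss-add (s x) y def) ⟩
    missing (addS s x y) + miss (s x)               ≡⟨ sum-upd miss s x (add (s x) y) ⟩
    missing s + miss (add (s x) y)                  ∎)
    where open ≡-Reasoning

  rem-missing : ∀ s x y → 1 ≤ mult (s x) y → missing (remS s x y) ≡ suc (missing s)
  rem-missing s x y le = +-cancelʳ-≡ (miss (s x)) _ _ (begin
    missing (remS s x y) + miss (s x)        ≡⟨ sum-upd miss s x (remove (s x) y) ⟩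
    missing s + miss (remove (s x) y)        ≡⟨ cong (missing s +_) (miss-remove (s x) y le) ⟩
    missing s + suc (miss (s x))             ≡⟨ +-suc (missing s) _ ⟩
    suc (missing s) + miss (s x)             ∎)
    where open ≡-Reasoning

  add-valid : ∀ {s} → Valid s → ∀ x y → 1 ≤ miss (s x) → adj G x y ≡ true → s y ≡ ctr → load s y ≤ 2 * k
    → Valid (addS s x y)
  add-valid {s} v x y def axy sy slack =
    upd-valid v x _ (miss⇒≢ctr def) (add≢ctr (s x) y def) ok bounds
    where
    ok : ∀ w → 1 ≤ mult (add (s x) y) w → adj G x w ≡ true × s w ≡ ctr
    ok w le with y ≟ w
    ... | yes refl = axy , sy
    ... | no ne = sends-adj v x w le′ , sends-ctr v x w le′
      where
      le′ : 1 ≤ mult (s x) w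
      le′ = subst (1 ≤_) (trans (mult-add (s x) y def w) (trans (cong (mult (s x) w +_) (δ-≢ ne)) (+-identityʳ _))) le
    bounds : ∀ w → s w ≡ ctr → 1 ≤ load (addS s x y) w × load (addS s x y) w ≤ cap
    bounds w e rewrite add-load s x y def w = ≤-trans (load-lo v w e) (m≤m+n _ (δ y w)) , hi (y ≟ w)
      where
      hi : Dec (y ≡ w) → load s w + δ y w ≤ cap
      hi (yes refl) = +-mono-≤ slack (δ≤1 y y)
      hi (no ne) rewrite δ-≢ ne | +-identityʳ (load s w) = load-hi v w e

  rem-valid : ∀ {s} → Valid s → ∀ x y → 1 ≤ mult (s x) y → 2 ≤ load s y → Valid (remS s x y)
  rem-valid {s} v x y snd ≥2 =
    upd-valid v x _ (sends⇒≢ctr snd) (remove≢ctr (s x) y (sends⇒≢ctr snd)) ok bounds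
    where
    ok : ∀ w → 1 ≤ mult (remove (s x) y) w → adj G x w ≡ true × s w ≡ ctr
    ok w le = sends-adj v x w le′ , sends-ctr v x w le′
      where
      le′ : 1 ≤ mult (s x) w
      le′ = subst (1 ≤_) (mult-remove (s x) y snd w) (≤-trans le (m≤m+n _ (δ y w)))
    bounds : ∀ w → s w ≡ ctr → 1 ≤ load (remS s x y) w × load (remS s x y) w ≤ cap
    bounds w e = lo (y ≟ w) , ≤-trans (m≤m+n _ (δ y w)) (subst (_≤ cap) (≡-sym eq) (load-hi v w e))
      where
      eq : load (remS s x y) w + δ y w ≡ load s w
      eq = rem-load s x y snd w
      lo : Dec (y ≡ w) → 1 ≤ load (remS s x y) w
      lo (yes refl) = +-cancelʳ-≤ 1 _ _ (subst (2 ≤_) (trans (≡-sym eq) (cong (load (remS s x y) y +_) (δ-refl y))) ≥2)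
      lo (no ne) = subst (1 ≤_) (trans (≡-sym eq) (trans (cong (load (remS s x y) w +_) (δ-≢ ne)) (+-identityʳ _))) (load-lo v w e)

  -- Here `x` becomes a centre and `y` sends it both units. If `y` was a centre, `only-x` ensures
  -- that nobody is left sending to it; `enough` ensures that erasing the old cells of `x` and `y`
  -- empties no other centre. This serves both to found a star at a deficient vertex and to reverse
  -- a star with a single leaf.
  module Restar {s : State n} (v : Valid s) (x y : Fin n) (x≢y : x ≢ y) (sx≢ : s x ≢ ctr) (axy : adj G x y ≡ true)
    (only-x : ∀ w → w ≢ x → mult (s w) y ≡ 0)
    (enough : ∀ c → s c ≡ ctr → c ≢ y → 1 + (mult (s x) c + mult (s y) c) ≤ load s c) where

    s₁ s′ : State n
    s₁ = upd s x ctr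
    s′ = upd s₁ y (two x x)

    s′y : s′ y ≡ two x x
    s′y = upd-same s₁ y _

    s′x : s′ x ≡ ctr
    s′x = trans (upd-other s₁ y _ x≢y) (upd-same s x _)

    s₁y : s₁ y ≡ s y
    s₁y = upd-other s x _ (λ e → x≢y (≡-sym e))

    s′-other : ∀ {w} → w ≢ x → w ≢ y → s′ w ≡ s w
    s′-other p q = trans (upd-other s₁ y _ q) (upd-other s x _ p)

    load-eq : ∀ c → load s′ c + (mult (s x) c + mult (s y) c) ≡ load s c + mult (two x x) c
    load-eq c = begin
      load s′ c + (mult (s x) c + mult (s y) c) ≡⟨ cong (load s′ c +_) (+-comm (mult (s x) c) _) ⟩
      load s′ c + (mult (s y) c + mult (s x) c) ≡⟨ +-assoc (load s′ c) _ _ ⟨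
      load s′ c + mult (s y) c + mult (s x) c   ≡⟨ cong (λ t → load s′ c + mult t c + mult (s x) c) s₁y ⟨
      load s′ c + mult (s₁ y) c + mult (s x) c  ≡⟨ cong (_+ mult (s x) c) (load-upd s₁ y (two x x) c) ⟩
      load s₁ c + mult (two x x) c + mult (s x) c ≡⟨ +-assoc (load s₁ c) _ _ ⟩
      load s₁ c + (mult (two x x) c + mult (s x) c) ≡⟨ cong (load s₁ c +_) (+-comm (mult (two x x) c) _) ⟩
      load s₁ c + (mult (s x) c + mult (two x x) c) ≡⟨ +-assoc (load s₁ c) _ _ ⟨
      load s₁ c + mult (s x) c + mult (two x x) c ≡⟨ cong (_+ mult (two x x) c) (trans (load-upd s x ctr c) (+-identityʳ _)) ⟩
      load s c + mult (two x x) c ∎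
      where open ≡-Reasoning

    load-x : load s′ x ≡ 2
    load-x = begin
      load s′ x                                 ≡⟨ +-identityʳ _ ⟨
      load s′ x + (0 + 0)                       ≡⟨ cong (load s′ x +_) (cong₂ _+_ (mult-noncentre v sx≢ x) (mult-noncentre v sx≢ y)) ⟨
      load s′ x + (mult (s x) x + mult (s y) x) ≡⟨ load-eq x ⟩
      load s x + mult (two x x) x               ≡⟨ cong₂ _+_ (load-noncentre v sx≢) (mult-two-same x) ⟩
      2 ∎
      where open ≡-Reasoning

    missing-eq : missing s′ + (miss (s x) + miss (s y)) ≡ missing s
    missing-eq = begin
      missing s′ + (miss (s x) + miss (s y)) ≡⟨ cong (missing s′ +_) (+-comm (miss (s x)) _) ⟩
      missing s′ + (miss (s y) + miss (s x)) ≡⟨ +-assoc (missing s′) _ _ ⟨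
      missing s′ + miss (s y) + miss (s x)   ≡⟨ cong (λ t → missing s′ + miss t + miss (s x)) s₁y ⟨
      missing s′ + miss (s₁ y) + miss (s x)  ≡⟨ cong (_+ miss (s x)) (trans (sum-upd miss s₁ y (two x x)) (+-identityʳ _)) ⟩
      missing s₁ + miss (s x)                ≡⟨ trans (sum-upd miss s x ctr) (+-identityʳ _) ⟩
      missing s ∎
      where open ≡-Reasoning

    centre-back : ∀ {c} → s′ c ≡ ctr → c ≢ x → c ≢ y × s c ≡ ctr
    centre-back {c} e c≢x = c≢y , trans (≡-sym (s′-other c≢x c≢y)) e
      where
      c≢y : c ≢ y
      c≢y refl with () ← trans (≡-sym s′y) e

    valid : Valid s′
    valid = record
      { sends-adj = λ w c → proj₁ ∘ ok w c
      ; sends-ctr = λ w c → proj₂ ∘ ok w c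
      ; load-lo   = λ c e → proj₁ (bounds c e)
      ; load-hi   = λ c e → proj₂ (bounds c e)
      }
      where
      ok : ∀ w c → 1 ≤ mult (s′ w) c → adj G w c ≡ true × s′ c ≡ ctr
      ok w c le with w ≟ y | w ≟ x
      ... | yes refl | _ with refl ← sends-two-same {a = x} {c} (subst (λ t → 1 ≤ mult t c) s′y le) = trans (sym G w x) axy , s′x
      ... | no _ | yes refl = contradiction (subst (λ t → 1 ≤ mult t c) s′x le) λ ()
      ... | no w≢y | no w≢x = sends-adj v w c le′ ,
          trans (s′-other (λ { refl → sx≢ sc }) (λ { refl → contradiction (subst (1 ≤_) (only-x w w≢x) le′) λ () })) sc
        where
        le′ : 1 ≤ mult (s w) c
        le′ = subst (λ t → 1 ≤ mult t c) (s′-other w≢x w≢y) le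
        sc : s c ≡ ctr
        sc = sends-ctr v w c le′
      bounds : ∀ c → s′ c ≡ ctr → 1 ≤ load s′ c × load s′ c ≤ cap
      bounds c e with c ≟ x
      ... | yes refl = subst (1 ≤_) (≡-sym load-x) (s≤s z≤n) , subst (_≤ cap) (≡-sym load-x) (≤-trans (s≤s (s≤s z≤n)) 5≤cap)
      ... | no c≢x =
          +-cancelʳ-≤ (mult (s x) c + mult (s y) c) _ _ (subst (1 + (mult (s x) c + mult (s y) c) ≤_) (≡-sym eq) (enough c sc c≢y)) ,
          ≤-trans (m≤m+n _ _) (subst (_≤ cap) (≡-sym eq) (load-hi v c sc))
        where
        c≢y = proj₁ (centre-back e c≢x)
        sc = proj₂ (centre-back e c≢x)
        eq : load s′ c + (mult (s x) c + mult (s y) c) ≡ load s c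
        eq = trans (load-eq c) (trans (cong (load s c +_) (mult-two-≢ (λ e → c≢x (≡-sym e)) (λ e → c≢x (≡-sym e)))) (+-identityʳ _))

  -- The path a – z – b is turned into a star centred at z.
  module FlipPath {s : State n} (v : Valid s) (z a b : Fin n) (sz : s z ≡ two a b) (a≢b : a ≢ b)
    (la : load s a ≡ 1) (lb : load s b ≡ 1) where

    s₁ s₂ s′ : State n
    s₁ = upd s z ctr
    s₂ = upd s₁ a (two z z)
    s′ = upd s₂ b (two z z)

    za : 1 ≤ mult (s z) a
    za rewrite sz = sends-fst a b

    zb : 1 ≤ mult (s z) b
    zb rewrite sz = sends-snd a b

    sa : s a ≡ ctr
    sa = sends-ctr v z a za

    sb : s b ≡ ctr
    sb = sends-ctr v z b zb

    sz≢ : s z ≢ ctr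
    sz≢ = sends⇒≢ctr za

    a≢z : a ≢ z
    a≢z refl = sz≢ sa

    b≢z : b ≢ z
    b≢z refl = sz≢ sb

    b≢a : b ≢ a
    b≢a e = a≢b (≡-sym e)

    s′b : s′ b ≡ two z z
    s′b = upd-same s₂ b _

    s′a : s′ a ≡ two z z
    s′a = trans (upd-other s₂ b _ a≢b) (upd-same s₁ a _)

    s′z : s′ z ≡ ctr
    s′z = trans (upd-other s₂ b _ (λ e → b≢z (≡-sym e))) (trans (upd-other s₁ a _ (λ e → a≢z (≡-sym e))) (upd-same s z _))

    s₁a : s₁ a ≡ ctr
    s₁a = trans (upd-other s z _ a≢z) sa

    s₂b : s₂ b ≡ ctr
    s₂b = trans (upd-other s₁ a _ b≢a) (trans (upd-other s z _ b≢z) sb)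

    s′-other : ∀ {w} → w ≢ z → w ≢ a → w ≢ b → s′ w ≡ s w
    s′-other p q r = trans (upd-other s₂ b _ r) (trans (upd-other s₁ a _ q) (upd-other s z _ p))

    -- For an arbitrary weight of cells, so that missing units, splits and every load are instances.
    -- Of the old cells `two a b`, `ctr`, `ctr` and the new cells `ctr`, `two z z`, `two z z`, one
    -- `ctr` has been cancelled.
    sum-eq : ∀ f → sum (f ∘ s′) + (f ctr + f (two a b)) ≡ sum (f ∘ s) + (f (two z z) + f (two z z))
    sum-eq f = begin
      S′ + (f ctr + f (two a b))   ≡⟨ +-assoc S′ _ _ ⟨
      S′ + f ctr + f (two a b)     ≡⟨ cong (λ t → S′ + f t + f (two a b)) s₂b ⟨
      S′ + f (s₂ b) + f (two a b)  ≡⟨ cong (_+ f (two a b)) (sum-upd f s₂ b (two z z)) ⟩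
      S₂ + t + f (two a b)         ≡⟨ swap S₂ t _ ⟩
      S₂ + f (two a b) + t         ≡⟨ cong (_+ t) step₂ ⟩
      S + t + t                    ≡⟨ +-assoc S t t ⟩
      S + (t + t)                  ∎
      where
      open ≡-Reasoning
      S = sum (f ∘ s)
      S₁ = sum (f ∘ s₁)
      S₂ = sum (f ∘ s₂)
      S′ = sum (f ∘ s′)
      t = f (two z z)
      swap : ∀ x y z → x + y + z ≡ x + z + y
      swap x y z = trans (+-assoc x y z) (trans (cong (x +_) (+-comm y z)) (≡-sym (+-assoc x z y)))
      step₂ : S₂ + f (two a b) ≡ S + t
      step₂ = +-cancelʳ-≡ (f ctr) _ _ (begin
        S₂ + f (two a b) + f ctr   ≡⟨ swap S₂ _ _ ⟩
        S₂ + f ctr + f (two a b)   ≡⟨ cong (λ c → S₂ + f c + f (two a b)) s₁a ⟨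
        S₂ + f (s₁ a) + f (two a b) ≡⟨ cong (_+ f (two a b)) (sum-upd f s₁ a (two z z)) ⟩
        S₁ + t + f (two a b)       ≡⟨ swap S₁ t _ ⟩
        S₁ + f (two a b) + t       ≡⟨ cong (λ c → S₁ + f c + t) sz ⟨
        S₁ + f (s z) + t           ≡⟨ cong (_+ t) (sum-upd f s z ctr) ⟩
        S + f ctr + t              ≡⟨ swap S _ t ⟩
        S + t + f ctr              ∎)

    missing-eq : missing s′ ≡ missing s
    missing-eq = trans (≡-sym (+-identityʳ _)) (trans (sum-eq miss) (+-identityʳ _))

    splits-eq : splits s′ + 1 ≡ splits s
    splits-eq = trans (cong (splits s′ +_) (≡-sym (split-≢ a≢b)))
      (trans (sum-eq split) (trans (cong (λ t → splits s + (t + t)) (split-same z)) (+-identityʳ _)))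

    load-z : load s′ z ≡ 4
    load-z = begin
      load s′ z                                ≡⟨ +-identityʳ _ ⟨
      load s′ z + 0                            ≡⟨ cong (load s′ z +_) (mult-two-≢ a≢z b≢z) ⟨
      load s′ z + mult (two a b) z             ≡⟨ sum-eq (λ c → mult c z) ⟩
      load s z + (mult (two z z) z + mult (two z z) z) ≡⟨ cong₂ _+_ (load-noncentre v sz≢) (cong₂ _+_ (mult-two-same z) (mult-two-same z)) ⟩
      4 ∎
      where open ≡-Reasoning

    load-other : ∀ {c} → c ≢ z → c ≢ a → c ≢ b → load s′ c ≡ load s c
    load-other {c} c≢z c≢a c≢b = begin
      load s′ c                    ≡⟨ +-identityʳ _ ⟨
      load s′ c + 0                ≡⟨ cong (load s′ c +_) (mult-two-≢ (λ e → c≢a (≡-sym e)) (λ e → c≢b (≡-sym e))) ⟨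
      load s′ c + mult (two a b) c ≡⟨ sum-eq (λ t → mult t c) ⟩
      load s c + (mult (two z z) c + mult (two z z) c) ≡⟨ cong (load s c +_) (cong₂ _+_ zz zz) ⟩
      load s c + 0                 ≡⟨ +-identityʳ _ ⟩
      load s c ∎
      where
      open ≡-Reasoning
      zz = mult-two-≢ {a = z} {z} {c} (λ e → c≢z (≡-sym e)) (λ e → c≢z (≡-sym e))

    only-z : ∀ {c} → load s c ≡ 1 → 1 ≤ mult (s z) c → ∀ w → w ≢ z → 1 ≤ mult (s w) c → ⊥
    only-z {c} l zc w w≢z wc = contradiction
      (≤-trans (+-mono-≤ wc zc) (≤-trans (two-terms≤sum (λ x → mult (s x) c) w≢z) (≤-reflexive l)))
      λ { (s≤s ()) }

    valid : Valid s′
    valid = record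
      { sends-adj = λ w c → proj₁ ∘ ok w c
      ; sends-ctr = λ w c → proj₂ ∘ ok w c
      ; load-lo   = λ c e → proj₁ (bounds c e)
      ; load-hi   = λ c e → proj₂ (bounds c e)
      }
      where
      ok : ∀ w c → 1 ≤ mult (s′ w) c → adj G w c ≡ true × s′ c ≡ ctr
      ok w c le with w ≟ b | w ≟ a | w ≟ z
      ... | yes refl | _ | _ with refl ← sends-two-same {a = z} {c} (subst (λ t → 1 ≤ mult t c) s′b le) =
        trans (sym G w z) (sends-adj v z w zb) , s′z
      ... | no _ | yes refl | _ with refl ← sends-two-same {a = z} {c} (subst (λ t → 1 ≤ mult t c) s′a le) =
        trans (sym G w z) (sends-adj v z w za) , s′z
      ... | no _ | no _ | yes refl = contradiction (subst (λ t → 1 ≤ mult t c) s′z le) λ ()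
      ... | no w≢b | no w≢a | no w≢z = sends-adj v w c le′ ,
          trans (s′-other (λ { refl → sz≢ sc }) (λ { refl → only-z la za w w≢z le′ }) (λ { refl → only-z lb zb w w≢z le′ })) sc
        where
        le′ : 1 ≤ mult (s w) c
        le′ = subst (λ t → 1 ≤ mult t c) (s′-other w≢z w≢a w≢b) le
        sc : s c ≡ ctr
        sc = sends-ctr v w c le′
      bounds : ∀ c → s′ c ≡ ctr → 1 ≤ load s′ c × load s′ c ≤ cap
      bounds c e with c ≟ z
      ... | yes refl = subst (1 ≤_) (≡-sym load-z) (s≤s z≤n) , subst (_≤ cap) (≡-sym load-z) (≤-trans (n≤1+n 4) 5≤cap)
      ... | no c≢z = subst (1 ≤_) (≡-sym eq) (load-lo v c sc) , subst (_≤ cap) (≡-sym eq) (load-hi v c sc)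
        where
        c≢a : c ≢ a
        c≢a refl with () ← trans (≡-sym s′a) e
        c≢b : c ≢ b
        c≢b refl with () ← trans (≡-sym s′b) e
        eq = load-other c≢z c≢a c≢b
        sc = trans (≡-sym (s′-other c≢z c≢a c≢b)) e

-- Optimal packings

-- `two` lists its centres in an arbitrary order; this is the unordered version, restricted to two
-- different centres.
Half : ∀ {n} → State n → (z p q : Fin n) → Set
Half s z p q = p ≢ q × (s z ≡ two p q ⊎ s z ≡ two q p)

half-swap : ∀ {n} {s : State n} {z p q} → Half s z p q → Half s z q p
half-swap (ne , inj₁ e) = (λ e → ne (≡-sym e)) , inj₂ e
half-swap (ne , inj₂ e) = (λ e → ne (≡-sym e)) , inj₁ e

half-sends : ∀ {n} {s : State n} {z p q} → Half s z p q → 1 ≤ mult (s z) p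
half-sends {p = p} {q} (ne , inj₁ e) rewrite e = sends-fst p q
half-sends {p = p} {q} (ne , inj₂ e) rewrite e = sends-snd q p

half-remove : ∀ {n} {s : State n} {z p q} → Half s z p q → remove (s z) q ≡ one p
half-remove {p = p} {q} (ne , inj₁ e) rewrite e with p ≟ q
... | yes eq = contradiction eq ne
... | no _   = refl
half-remove {p = p} {q} (ne , inj₂ e) rewrite e with q ≟ q
... | yes _  = refl
... | no neq = contradiction refl neq

half-split : ∀ {n} {s : State n} {z p q} → Half s z p q → split (s z) ≡ 1
half-split (ne , inj₁ e) rewrite e = split-≢ ne
half-split (ne , inj₂ e) rewrite e = split-≢ (λ e → ne (≡-sym e))

module Optimum (k : ℕ) (2≤k : 2 ≤ k) {n : ℕ} (G : Graph (Fin n)) where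

  open Packing k 2≤k G
  open Packing.Valid

  missing-cong : ∀ {s s′ : State n} → (∀ x → s x ≡ s′ x) → missing s ≡ missing s′
  missing-cong eq = sum-cong-≗ (cong miss ∘ eq)

  all-free : Valid (λ _ → free)
  all-free = record { sends-adj = λ _ _ () ; sends-ctr = λ _ _ () ; load-lo = λ _ () ; load-hi = λ _ () }

  MissMin : State n → Set
  MissMin s = ∀ s′ → Valid s′ → missing s ≤ missing s′

  SplitMin : State n → Set
  SplitMin s = ∀ s′ → Valid s′ → missing s′ ≡ missing s → splits s ≤ splits s′

  optimum : Σ[ s ∈ State n ] Valid s × MissMin s × SplitMin s
  optimum = lookup w , wv , missMin , splitMin
    where
    S : Searchable (Vec (Cell n) n)
    S = search-Vec search-Cell n
    first = minimise S (λ v → valid? (lookup v)) (λ v → missing (lookup v))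
      (tabulate (λ _ → free) , valid-cong (λ x → ≡-sym (lookup∘tabulate (λ _ → free) x)) all-free)
    v = proj₁ first
    -- Lexicographic minimisation: the second search is confined to packings with at most the least
    -- number of missing units, so its winner is optimal for both counts.
    second = minimise S (λ w → valid? (lookup w) ×-dec (missing (lookup w) ≤? missing (lookup v)))
      (λ w → splits (lookup w)) (v , proj₁ (proj₂ first) , ≤-refl)
    w = proj₁ second
    wv = proj₁ (proj₁ (proj₂ second))
    toVec : ∀ {s} → Valid s → Valid (lookup (tabulate s))
    toVec {s} = valid-cong (λ x → ≡-sym (lookup∘tabulate s x))
    missMin : MissMin (lookup w)
    missMin s val = ≤-trans (proj₂ (proj₁ (proj₂ second)))
      (≤-trans (proj₂ (proj₂ first) (tabulate s) (toVec val)) (≤-reflexive (missing-cong (lookup∘tabulate s))))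
    splitMin : SplitMin (lookup w)
    splitMin s val eq = ≤-trans
      (proj₂ (proj₂ second) (tabulate s) (toVec val , ≤-trans (≤-reflexive (trans (missing-cong (lookup∘tabulate s)) eq)) (proj₂ (proj₁ (proj₂ second)))))
      (≤-reflexive (sum-cong-≗ (cong split ∘ lookup∘tabulate s)))

  slack-or-tight : ∀ {s} → Valid s → ∀ y → s y ≡ ctr → load s y ≤ 2 * k ⊎ load s y ≡ cap
  slack-or-tight {s} v y e with load s y ≤? 2 * k
  ... | yes le = inj₁ le
  ... | no nle = inj₂ (≤-antisym (load-hi v y e) (subst (_≤ load s y) (+-comm 1 (2 * k)) (≰⇒> nle)))

  -- The unit that `z` sends to `q` goes to `p` instead, which makes `z` an unsplit sender of `p`.
  -- One split disappears and nothing goes missing; the two bounds provide room at `p` and keep `q`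
  -- from being emptied.
  module Push {s : State n} (v : Valid s) {z p q : Fin n} (h : Half s z p q)
    (slack : load s p ≤ 2 * k) (2≤q : 2 ≤ load s q) where

    s₁ s′ : State n
    s₁ = remS s z q
    s′ = addS s₁ z p

    zp : 1 ≤ mult (s z) p
    zp = half-sends {s = s} h

    zq : 1 ≤ mult (s z) q
    zq = half-sends {s = s} (half-swap {s = s} h)

    s₁z : s₁ z ≡ one p
    s₁z = trans (upd-same s z _) (half-remove {s = s} h)

    def : 1 ≤ miss (s₁ z)
    def rewrite s₁z = ≤-refl

    load-eq : ∀ w → load s′ w + δ q w ≡ load s w + δ p w
    load-eq w = begin
      load s′ w + δ q w          ≡⟨ cong (_+ δ q w) (add-load s₁ z p def w) ⟩
      load s₁ w + δ p w + δ q w  ≡⟨ +-assoc (load s₁ w) _ _ ⟩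
      load s₁ w + (δ p w + δ q w) ≡⟨ cong (load s₁ w +_) (+-comm (δ p w) _) ⟩
      load s₁ w + (δ q w + δ p w) ≡⟨ +-assoc (load s₁ w) _ _ ⟨
      load s₁ w + δ q w + δ p w  ≡⟨ cong (_+ δ p w) (rem-load s z q zq w) ⟩
      load s w + δ p w           ∎
      where open ≡-Reasoning

    valid : Valid s′
    valid = add-valid (rem-valid v z q zq 2≤q) z p def (sends-adj v z p zp)
      (trans (upd-other s z _ λ { refl → sends⇒≢ctr zp (sends-ctr v p p zp) }) (sends-ctr v z p zp))
      (≤-trans (≤-trans (m≤m+n _ (δ q p)) (≤-reflexive (rem-load s z q zq p))) slack)

    missing-eq : missing s′ ≡ missing s
    missing-eq = cong Data.Nat.pred (trans (add-missing s₁ z p def) (rem-missing s z q zq))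

    splits-eq : suc (splits s′) ≡ splits s
    splits-eq = begin
      suc (splits s′)                     ≡⟨ +-comm 1 (splits s′) ⟩
      splits s′ + 1                       ≡⟨ cong (_+ 1) (+-identityʳ _) ⟨
      splits s′ + 0 + 1                   ≡⟨ cong (λ c → splits s′ + split c + 1) s₁z ⟨
      splits s′ + split (s₁ z) + 1        ≡⟨ cong (_+ 1) (sum-upd split s₁ z (add (s₁ z) p)) ⟩
      splits s₁ + split (add (s₁ z) p) + 1 ≡⟨ cong (λ c → splits s₁ + split (add c p) + 1) s₁z ⟩
      splits s₁ + split (two p p) + 1     ≡⟨ cong (λ t → splits s₁ + t + 1) (split-same p) ⟩
      splits s₁ + 0 + 1                   ≡⟨ cong (_+ 1) (+-identityʳ _) ⟩
      splits s₁ + 1                       ≡⟨ cong (splits s₁ +_) (half-split {s = s} h) ⟨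
      splits s₁ + split (s z)             ≡⟨ sum-upd split s z (remove (s z) q) ⟩
      splits s + split (remove (s z) q)   ≡⟨ cong (splits s +_) (split-remove (s z) q) ⟩
      splits s + 0                        ≡⟨ +-identityʳ _ ⟩
      splits s ∎
      where open ≡-Reasoning

    unchanged : ∀ {w} → w ≢ z → s′ w ≡ s w
    unchanged ne = trans (upd-other s₁ z _ ne) (upd-other s z _ ne)

  1≤2k : 1 ≤ 2 * k
  1≤2k = ≤-trans (s≤s z≤n) (*-monoʳ-≤ 2 2≤k)

  add-improves : ∀ {s} → Valid s → MissMin s → ∀ x y → 1 ≤ miss (s x) → adj G x y ≡ true → s y ≡ ctr
    → load s y ≡ cap
  add-improves {s} v mm x y def axy sy with slack-or-tight v y sy
  ... | inj₂ t = t
  ... | inj₁ slack = contradiction (≤-trans (≤-reflexive (add-missing s x y def)) (mm _ (add-valid v x y def axy sy slack))) (<-irrefl refl)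

  -- A centre that is not full is fed by unsplit vertices only. This replaces `SplitMin` along
  -- alternating paths: moving a unit may turn `one a` into a split cell, but only with full centres
  -- at its ends.
  Good : State n → Set
  Good s = ∀ x y → 1 ≤ mult (s x) y → load s y ≡ cap ⊎ s x ≡ two y y

  -- If `p` has slack, pushing the unit over from `q` is blocked only when `q` has load 1. Then `q`
  -- has slack as well, so by symmetry `p` has load 1, and the isolated path p - z - q can be
  -- flipped into a star without splits.
  halves-tight : ∀ {s} → Valid s → SplitMin s → ∀ {z p q} → Half s z p q → load s p ≡ cap
  halves-tight {s} v sm {z} {p} {q} h with slack-or-tight v p (sends-ctr v z p (half-sends {s = s} h))
  ... | inj₂ t = t
  ... | inj₁ slack = ⊥-elim (flip h)
    where
    no-push : ∀ {p q} → Half s z p q → load s p ≤ 2 * k → load s q ≡ 1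
    no-push {p} {q} h slack with 2 ≤? load s q
    ... | yes 2≤q = contradiction (≤-trans (≤-reflexive splits-eq) (sm s′ valid missing-eq)) (<-irrefl refl)
      where open Push v h slack 2≤q
    ... | no nle = ≤-antisym (≤-pred (≰⇒> nle)) (load-lo v q (sends-ctr v z q (half-sends {s = s} (half-swap {s = s} h))))
    lq : load s q ≡ 1
    lq = no-push h slack
    lp : load s p ≡ 1
    lp = no-push (half-swap {s = s} h) (≤-trans (≤-reflexive lq) 1≤2k)
    flip′ : ∀ {a b} → s z ≡ two a b → a ≢ b → load s a ≡ 1 → load s b ≡ 1 → ⊥
    flip′ e ne la lb = <-irrefl refl (≤-trans (≤-reflexive (trans (+-comm 1 _) splits-eq)) (sm s′ valid missing-eq))
      where open FlipPath v z _ _ e ne la lb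
    flip : Half s z p q → ⊥
    flip (ne , inj₁ e) = flip′ e ne lp lq
    flip (ne , inj₂ e) = flip′ e (λ e → ne (≡-sym e)) lq lp

  good : ∀ {s} → Valid s → MissMin s → SplitMin s → Good s
  good {s} v mm sm x y le with s x in eq
  ... | one a with refl ← δ-≡ {a = a} {y} le =
    inj₁ (add-improves v mm x y (subst (λ c → 1 ≤ miss c) (≡-sym eq) ≤-refl) (sends-adj v x y le′) (sends-ctr v x y le′))
    where
    le′ : 1 ≤ mult (s x) y
    le′ = subst (λ c → 1 ≤ mult c y) (≡-sym eq) le
  ... | two a b with a ≟ b
  ...   | yes refl with refl ← sends-two-same {a = a} {y} le = inj₂ refl
  ...   | no ne with sends-two {a = a} {b} {y} le
  ...     | inj₁ refl = inj₁ (halves-tight v sm (ne , inj₁ eq))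
  ...     | inj₂ refl = inj₁ (halves-tight v sm ((λ e → ne (≡-sym e)) , inj₂ eq))

  module Local {s : State n} (v : Valid s) (mm : MissMin s) (gd : Good s)
    {x y : Fin n} (def : 1 ≤ miss (s x)) (axy : adj G x y ≡ true) where

    x≢y : x ≢ y
    x≢y refl = true≢false axy (irrefl G x)

    mult-deficient≤1 : ∀ {c : Cell n} → 1 ≤ miss c → ∀ w → mult c w ≤ 1
    mult-deficient≤1 {c} d w = ≤-trans (mult≤units c w) (≤-pred (miss⇒units<2 c d))

    -- Otherwise `x` could become a centre served by `y`, and at least the missing unit of `x` would
    -- be saved. The only centre that this might empty is one served by `y` with both units, which
    -- is why `big` is assumed.
    new-star : s y ≢ ctr → (∀ c → s y ≡ two c c → 3 ≤ load s c) → ⊥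
    new-star sy≢ big = <-irrefl refl (≤-trans
      (≤-trans (+-monoʳ-≤ 1 (mm s′ valid)) (≤-trans (≤-reflexive (+-comm 1 _)) (+-monoʳ-≤ (missing s′) (≤-trans def (m≤m+n _ (miss (s y)))))))
      (≤-reflexive missing-eq))
      where
      enough : ∀ c → s c ≡ ctr → c ≢ y → 1 + (mult (s x) c + mult (s y) c) ≤ load s c
      enough c sc c≢y with slack-or-tight v c sc
      -- The deficient `x` sends at most one unit and `y` at most two, so a full centre keeps some.
      -- The remaining cases concern centres with slack, where `Good` leaves only the cell `two c c`
      -- of `y`.
      ... | inj₂ t rewrite t = ≤-trans (+-monoʳ-≤ 1 (+-mono-≤ (mult-deficient≤1 def c) (≤-trans (mult≤units (s y) c) (units≤2 (s y)))))
                                 (≤-trans (n≤1+n 4) 5≤cap)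
      ... | inj₁ slack with 1 ≤? mult (s x) c
      ...   | yes sx with gd x c sx
      ...     | inj₁ t = contradiction (≤-trans (≤-reflexive (trans (+-comm 1 _) (≡-sym t))) slack) (<-irrefl refl)
      ...     | inj₂ e = contradiction (subst (λ c → 1 ≤ miss c) e def) λ ()
      enough c sc c≢y | inj₁ slack | no ¬sx rewrite n<1⇒n≡0 (≰⇒> ¬sx) with 1 ≤? mult (s y) c
      ... | no ¬sy rewrite n<1⇒n≡0 (≰⇒> ¬sy) = load-lo v c sc
      ... | yes sy with gd y c sy
      ...   | inj₁ t = contradiction (≤-trans (≤-reflexive (trans (+-comm 1 _) (≡-sym t))) slack) (<-irrefl refl)
      ...   | inj₂ e = ≤-trans (+-monoʳ-≤ 1 (≤-trans (mult≤units (s y) c) (units≤2 (s y)))) (big c e)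
      open Restar v x y x≢y (miss⇒≢ctr def) axy (λ w _ → mult-noncentre v sy≢ w) enough

    -- With load at most 2 the star at `c` is the single edge y - c. Reversing it costs nothing and
    -- makes `y` a centre of load 2 next to the deficient `x`, which contradicts `add-improves` in
    -- the reversed packing.
    flip-edge : ∀ c → s y ≡ two c c → load s c ≤ 2 → ⊥
    flip-edge c sy small = contradiction (trans (≡-sym load-x) tight) λ e → <⇒≢ (≤-trans (s≤s (s≤s (s≤s z≤n))) 5≤cap) e
      where
      yc : mult (s y) c ≡ 2
      yc = trans (cong (λ t → mult t c) sy) (mult-two-same c)
      yc≥1 : 1 ≤ mult (s y) c
      yc≥1 = subst (1 ≤_) (≡-sym yc) (s≤s z≤n)
      sc : s c ≡ ctr
      sc = sends-ctr v y c yc≥1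
      sy≢ : s y ≢ ctr
      sy≢ = sends⇒≢ctr yc≥1
      only : ∀ w → w ≢ y → mult (s w) c ≡ 0
      only w ne = n<1⇒n≡0 (+-cancelʳ-≤ 2 _ _ (s≤s (subst (λ t → mult (s w) c + t ≤ 2) yc
        (≤-trans (two-terms≤sum (λ x → mult (s x) c) ne) small))))
      enough : ∀ d → s d ≡ ctr → d ≢ c → 1 + (mult (s y) d + mult (s c) d) ≤ load s d
      enough d sd ne rewrite sc | sy | mult-two-≢ {a = c} {c} {d} (λ e → ne (≡-sym e)) (λ e → ne (≡-sym e)) = load-lo v d sd
      y≢c : y ≢ c
      y≢c refl = sy≢ sc
      open Restar v y c y≢c sy≢ (sends-adj v y c yc≥1) only enough
      x≢c : x ≢ c
      x≢c refl = miss⇒≢ctr def sc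
      mm′ : MissMin s′
      mm′ t tv = ≤-trans (≤-reflexive (trans (≡-sym (+-identityʳ _)) (trans (cong (missing s′ +_) zeros) missing-eq))) (mm t tv)
        where
        zeros : 0 ≡ miss (s y) + miss (s c)
        zeros rewrite sy | sc = refl
      tight : load s′ y ≡ cap
      tight = add-improves valid mm′ x y (subst (λ c → 1 ≤ miss c) (≡-sym (s′-other x≢y x≢c)) def) axy s′x

    neighbour : s y ≡ ctr × load s y ≡ cap
    neighbour with ctr? (s y)
    ... | yes sy = sy , add-improves v mm x y def axy sy
    ... | no sy≢ = ⊥-elim (new-star sy≢ λ c e → ≰⇒> (flip-edge c e))

  module Alternating {s₀ : State n} (mm₀ : MissMin s₀) where

    -- Since all loads agree with those of `s₀`, whatever the deficiency of `x` implies about loads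
    -- in `s` can be read off in the original packing.
    record Rerooted (s : State n) (x : Fin n) : Set where
      field
        valid   : Valid s
        missing≡ : missing s ≡ missing s₀
        load≡   : ∀ y → load s y ≡ load s₀ y
        isGood  : Good s
        deficient : 1 ≤ miss (s x)

    open Rerooted

    missMin : ∀ {s x} → Rerooted s x → MissMin s
    missMin r t tv = ≤-trans (≤-reflexive (missing≡ r)) (mm₀ t tv)

    neighbour : ∀ {s x} → Rerooted s x → ∀ {y} → adj G x y ≡ true → s y ≡ ctr × load s y ≡ cap
    neighbour r = Local.neighbour (valid r) (missMin r) (isGood r) (deficient r)

    -- x takes over a unit that x′ sends to y.
    module Shift {s : State n} {x : Fin n} (r : Rerooted s x) {y x′ : Fin n} (axy : adj G x y ≡ true)
      (x′y : 1 ≤ mult (s x′) y) (x′≢x : x′ ≢ x) where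

      s₁ s′ : State n
      s₁ = remS s x′ y
      s′ = addS s₁ x y

      sy : s y ≡ ctr
      sy = proj₁ (neighbour r axy)

      tight : load s y ≡ cap
      tight = proj₂ (neighbour r axy)

      s₁x : s₁ x ≡ s x
      s₁x = upd-other s x′ _ (λ e → x′≢x (≡-sym e))

      def : 1 ≤ miss (s₁ x)
      def = subst (λ c → 1 ≤ miss c) (≡-sym s₁x) (deficient r)

      s′x : s′ x ≡ add (s x) y
      s′x = trans (upd-same s₁ x _) (cong (λ c → add c y) s₁x)

      s′x′ : s′ x′ ≡ remove (s x′) y
      s′x′ = trans (upd-other s₁ x _ x′≢x) (upd-same s x′ _)

      s′-other : ∀ {w} → w ≢ x → w ≢ x′ → s′ w ≡ s w
      s′-other p q = trans (upd-other s₁ x _ p) (upd-other s x′ _ q)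

      load-s₁ : load s₁ y ≤ 2 * k
      load-s₁ = +-cancelʳ-≤ 1 _ _ (≤-reflexive (trans (cong (load s₁ y +_) (≡-sym (δ-refl y))) (trans (rem-load s x′ y x′y y) tight)))

      load-eq : ∀ w → load s′ w ≡ load s w
      load-eq w = trans (add-load s₁ x y def w) (rem-load s x′ y x′y w)

      rerooted : Rerooted s′ x′
      rerooted = record
        { valid = add-valid (rem-valid (valid r) x′ y x′y (subst (2 ≤_) (≡-sym tight) (≤-trans (s≤s (s≤s z≤n)) 5≤cap)))
            x y def axy (trans (upd-other s x′ _ λ { refl → sends⇒≢ctr x′y sy }) sy) load-s₁
        ; missing≡ = trans (cong Data.Nat.pred (trans (add-missing s₁ x y def) (rem-missing s x′ y x′y))) (missing≡ r)
        ; load≡ = λ w → trans (load-eq w) (load≡ r w)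
        ; isGood = λ w c le → gd w c (w ≟ x) (w ≟ x′) le
        ; deficient = subst (λ c → 1 ≤ miss c) (≡-sym s′x′) (subst (1 ≤_) (≡-sym (miss-remove (s x′) y x′y)) (s≤s z≤n))
        }
        where
        tight′ : load s′ y ≡ cap
        tight′ = trans (load-eq y) tight
        gd : ∀ w c → Dec (w ≡ x) → Dec (w ≡ x′) → 1 ≤ mult (s′ w) c → load s′ c ≡ cap ⊎ s′ w ≡ two c c
        gd w c (yes refl) _ le with y ≟ c
        ... | yes refl = inj₁ tight′
        ... | no y≢c with isGood r x c (subst (1 ≤_) (trans (cong (λ t → mult t c) s′x)
                              (trans (mult-add (s x) y (deficient r) c) (trans (cong (mult (s x) c +_) (δ-≢ y≢c)) (+-identityʳ _)))) le)
        ...   | inj₁ t = inj₁ (trans (load-eq c) t)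
        ...   | inj₂ e = contradiction (subst (λ c → 1 ≤ miss c) e (deficient r)) λ ()
        gd w c (no _) (yes refl) le with isGood r x′ c (≤-trans (subst (λ t → 1 ≤ mult t c) s′x′ le)
                                           (≤-trans (m≤m+n _ (δ y c)) (≤-reflexive (mult-remove (s x′) y x′y c))))
        ... | inj₁ t = inj₁ (trans (load-eq c) t)
        -- An unsplit `x′` that gave up a unit of `y` was serving `y` alone, and `y` is full, so its
        -- remaining unit is harmless.
        ... | inj₂ e with refl ← sends-two-same {a = c} {y} (subst (λ t → 1 ≤ mult t y) e x′y) = inj₁ tight′
        gd w c (no p) (no q) le with isGood r w c (subst (λ t → 1 ≤ mult t c) (s′-other p q) le)
        ... | inj₁ t = inj₁ (trans (load-eq c) t)
        ... | inj₂ e = inj₂ (trans (s′-other p q) e)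

      keeps : ∀ w c → w ≢ x′ → 1 ≤ mult (s w) c → 1 ≤ mult (s′ w) c
      keeps w c w≢x′ le with w ≟ x
      ... | yes refl rewrite s′x | mult-add (s x) y (deficient r) c = ≤-trans le (m≤m+n _ (δ y c))
      ... | no w≢x = subst (λ t → 1 ≤ mult t c) (≡-sym (s′-other w≢x w≢x′)) le

    -- The units on the path refer to one fixed packing, so a shift may break the rest of the path
    -- and the tail must then be repaired. The length index provides the measure for this.
    data Path (s : State n) : ℕ → Fin n → Fin n → Set where
      nil  : ∀ {x} → Path s 0 x x
      cons : ∀ {m x y x′ t} → adj G x y ≡ true → 1 ≤ mult (s x′) y → Path s m x′ t → Path s (suc m) x t

    -- After a change at w only, continue from the last visit to w.
    detour : ∀ {s s′ w} → (∀ x y → x ≢ w → 1 ≤ mult (s x) y → 1 ≤ mult (s′ x) y)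
      → ∀ {m z t} → Path s m z t → Σ[ m′ ∈ ℕ ] m′ ≤ m × (Path s′ m′ z t ⊎ Path s′ m′ w t)
    detour keeps nil = 0 , z≤n , inj₁ nil
    detour {w = w} keeps (cons {x′ = x′} axy x′y p) with detour keeps p
    ... | m′ , le , inj₂ q = m′ , m≤n⇒m≤1+n le , inj₂ q
    ... | m′ , le , inj₁ q with x′ ≟ w
    ...   | yes refl = m′ , m≤n⇒m≤1+n le , inj₂ q
    ...   | no ne = suc m′ , s≤s le , inj₁ (cons axy (keeps x′ _ ne x′y) q)

    -- The deficiency travels along the path by one shift at a time. The repaired tail is not a
    -- subterm of the old path, only no longer than it, so the recursion runs on a bound for the
    -- length.
    reroot : ∀ fuel {m s x t} → m ≤ fuel → Rerooted s x → Path s m x t → ∃[ s′ ] Rerooted s′ t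
    reroot fuel le r nil = _ , r
    reroot (suc fuel) {x = x} (s≤s le) r (cons {x′ = x′} axy x′y p) with x′ ≟ x
    ... | yes refl = reroot fuel le r p
    ... | no ne with detour (Shift.keeps r axy x′y ne) p
    ...   | m′ , le′ , inj₁ q = reroot fuel (≤-trans le′ le) (Shift.rerooted r axy x′y ne) q
    ...   | m′ , le′ , inj₂ q = reroot fuel (≤-trans le′ le) (Shift.rerooted r axy x′y ne) q

  -- 2·i(G − S) ≤ (2k+1)|S|, with E playing the isolated vertices of G − S.
  IsolatedBound : Set
  IsolatedBound = ∀ (E S : Fin n → Bool) → (∃[ u ] E u ≡ true)
    → (∀ x y → E x ≡ true → adj G x y ≡ true → S y ≡ true)
    → (∀ x → E x ≡ true → S x ≡ true → ⊥)
    → 2 * count E ≤ cap * count S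

  module NoneMissing (hall : IsolatedBound) {s : State n} (v : Valid s) (mm : MissMin s) (gd : Good s) where

    open Alternating mm
    open Rerooted

    module Violator (u : Fin n) (u-def : 1 ≤ miss (s u)) where

      alt? : ∀ x x′ → Dec (∃[ y ] adj G x y ≡ true × 1 ≤ mult (s x′) y)
      alt? x x′ = any? (λ y → (adj G x y Data.Bool.≟ true) ×-dec (1 ≤? mult (s x′) y))

      open Closure (λ x x′ → ⌊ alt? x x′ ⌋) u renaming (reachable to E)

      toPath : ∀ {x t} → Reach (λ x x′ → ⌊ alt? x x′ ⌋) x t → ∃[ m ] Path s m x t
      toPath here = 0 , nil
      toPath (step {x} {x′} e p) =
        let y , axy , x′y = ⌊⌋-true (alt? x x′) e ; m , q = toPath p in suc m , cons axy x′y q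

      rerooted-E : ∀ x → E x ≡ true → ∃[ s′ ] Rerooted s′ x
      rerooted-E x ex = let m , p = toPath (Equivalence.to (reachable⇔ x) ex) in
        reroot m ≤-refl (record { valid = v ; missing≡ = refl ; load≡ = λ _ → refl ; isGood = gd ; deficient = u-def }) p

      nbr? : ∀ y → Dec (∃[ x ] E x ≡ true × adj G x y ≡ true)
      nbr? y = any? (λ x → (E x Data.Bool.≟ true) ×-dec (adj G x y Data.Bool.≟ true))

      S : Fin n → Bool
      S y = ⌊ nbr? y ⌋

      Eu : E u ≡ true
      Eu = Equivalence.from (reachable⇔ u) here

      S-tight : ∀ y → S y ≡ true → load s y ≡ cap
      S-tight y sy =
        let x , ex , axy = ⌊⌋-true (nbr? y) sy ; s′ , r = rerooted-E x ex in
        trans (≡-sym (load≡ r y)) (proj₂ (neighbour r axy))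

      E-unloaded : ∀ x → E x ≡ true → load s x ≡ 0
      E-unloaded x ex = let s′ , r = rerooted-E x ex in
        trans (≡-sym (load≡ r x)) (load-noncentre (valid r) (miss⇒≢ctr (deficient r)))

      -- A sender to a neighbour of `E` is one alternating step further on, hence in `E`. This is
      -- why the units of `S` can be charged to `E` alone.
      closed : ∀ x′ y → S y ≡ true → 1 ≤ mult (s x′) y → E x′ ≡ true
      closed x′ y sy le =
        let x , ex , axy = ⌊⌋-true (nbr? y) sy in
        Equivalence.from (reachable⇔ x′) (Reach-trans (Equivalence.to (reachable⇔ x) ex)
          (step (⌊⌋-intro (alt? x x′) (y , axy , le)) here))

      in-S : Fin n → Fin n → ℕ
      in-S x y = ind (S y) * mult (s x) y

      in-S≤ : ∀ x y → in-S x y ≤ mult (s x) y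
      in-S≤ x y with S y
      ... | true  = ≤-reflexive (+-identityʳ _)
      ... | false = z≤n

      sent : ∀ x → sum (in-S x) ≤ 2 * ind (E x)
      sent x with E x in ex
      ... | true  = ≤-trans (sum-mono (in-S≤ x)) (≤-trans (≤-reflexive (sum-mult (s x))) (units≤2 (s x)))
      ... | false = ≤-reflexive (sum-zero λ y → nothing y (S y) refl)
        where
        nothing : ∀ y b → S y ≡ b → ind b * mult (s x) y ≡ 0
        nothing y false e = refl
        nothing y true  e = trans (+-identityʳ _) (n<1⇒n≡0 (≰⇒> λ le → true≢false (closed x y e le) ex))

      sent-u : sum (in-S u) < 2 * ind (E u)
      sent-u rewrite Eu = ≤-<-trans (sum-mono (in-S≤ u)) (≤-<-trans (≤-reflexive (sum-mult (s u))) (miss⇒units<2 (s u) u-def))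

      received : ∀ y → cap * ind (S y) ≡ sum (λ x → in-S x y)
      received y = trans (weigh (S y) refl) (≡-sym (sum-*ˡ (ind (S y)) (λ x → mult (s x) y)))
        where
        weigh : ∀ b → S y ≡ b → cap * ind b ≡ ind b * load s y
        weigh true  e = trans (*-identityʳ cap) (trans (≡-sym (S-tight y e)) (≡-sym (+-identityʳ _)))
        weigh false e = *-zeroʳ cap

      -- Double count of the units arriving in `S`: every vertex of `S` receives exactly `cap`,
      -- every vertex of `E` sends at most two, vertices outside `E` send none, and `u` sends fewer
      -- than two. This last point gives strictness.
      violation : cap * count S < 2 * count E
      violation = begin-strict
        cap * count S                   ≡⟨ cong (cap *_) (count-sum S) ⟩
        cap * sum (ind ∘ S)             ≡⟨ sum-*ˡ cap (ind ∘ S) ⟨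
        sum (λ y → cap * ind (S y))     ≡⟨ sum-cong-≗ received ⟩
        sum (λ y → sum (λ x → in-S x y)) ≡⟨ ∑-comm (λ y x → in-S x y) ⟩
        sum (λ x → sum (in-S x))        <⟨ sum-strict sent u sent-u ⟩
        sum (λ x → 2 * ind (E x))       ≡⟨ sum-*ˡ 2 (ind ∘ E) ⟩
        2 * sum (ind ∘ E)               ≡⟨ cong (2 *_) (count-sum E) ⟨
        2 * count E                     ∎
        where open ≤-Reasoning

      impossible : ⊥
      impossible = <-irrefl refl (<-≤-trans violation (hall E S (u , Eu)
        (λ x y ex axy → ⌊⌋-intro (nbr? y) (x , ex , axy))
        -- A vertex in both sets would carry load 0, as it can be made deficient, and load `cap`, as
        -- it has a neighbour in `E`. Hence no two vertices of `E` are adjacent.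
        (λ x ex sx → contradiction (≤-trans (≤-trans (s≤s z≤n) 5≤cap) (≤-reflexive (trans (≡-sym (S-tight x sx)) (E-unloaded x ex)))) λ ())))

    none-missing : ∀ x → miss (s x) ≡ 0
    none-missing x = n<1⇒n≡0 (≰⇒> (Violator.impossible x))

-- The degree condition and cycles of split vertices

maxOf≤ : ∀ {m} (f : Fin m → ℕ) {b} → (∀ i → f i ≤ b) → maxOf f ≤ b
maxOf≤ {zero}  f h = z≤n
maxOf≤ {suc m} f h = ⊔-lub (h zero) (maxOf≤ (f ∘ suc) (h ∘ suc))

module _ (k : ℕ) (2≤k : 2 ≤ k) {n : ℕ} (G : Graph (Fin n)) (d : ℕ) where

  -- A violation makes `E` large enough to contain a set to which the degree condition applies. Its
  -- degrees are at most |S|, so 2n ≤ (2k+3)|S|; as `E` and `S` are disjoint, 2|E| + 2|S| ≤ 2n, and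
  -- subtracting 2|S| refutes the violation.
  isolated-bound : (∀ x → d ≤ deg (adj G) x)
    → (∀ (xs : Fin (k * d + d / 2 + 1) → Fin n) → Injective _≡_ _≡_ xs
       → (∀ i j → adj G (xs i) (xs j) ≡ false)
       → 2 * n ≤ (2 * k + 3) * maxOf (deg (adj G) ∘ xs))
    → Optimum.IsolatedBound k 2≤k G
  isolated-bound d≤ hyp E S (u , Eu) nbr disj with 2 * count E ≤? (2 * k + 1) * count S
  ... | yes le = le
  ... | no nle = contradiction bound (<⇒≱ big)
    where
    e = count E
    t = count S
    deg≤ : ∀ x → E x ≡ true → deg (adj G) x ≤ t
    deg≤ x ex = count-mono (adj G x) S (λ y → nbr x y ex)
    big : (2 * k + 1) * t < 2 * e
    big = ≰⇒> nle
    d≤t : d ≤ t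
    d≤t = ≤-trans (d≤ u) (deg≤ u Eu)
    -- Here `k * d + d / 2` is the floor of (k + 1/2)d. The neighbours of `u` lie in `S`, so d ≤ |S|
    -- and twice this floor is at most (2k+1)|S| < 2|E|.
    enough : k * d + d / 2 + 1 ≤ e
    enough = subst (_≤ e) (+-comm 1 _) (*-cancelˡ-< 2 _ _ (≤-<-trans double big))
      where
      open ≤-Reasoning
      double : 2 * (k * d + d / 2) ≤ (2 * k + 1) * t
      double = begin
        2 * (k * d + d / 2)       ≡⟨ *-distribˡ-+ 2 (k * d) _ ⟩
        2 * (k * d) + 2 * (d / 2) ≡⟨ cong₂ _+_ (≡-sym (*-assoc 2 k d)) (*-comm 2 (d / 2)) ⟩
        2 * k * d + d / 2 * 2     ≤⟨ +-monoʳ-≤ (2 * k * d) (m/n*n≤m d 2) ⟩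
        2 * k * d + d             ≡⟨ cong (2 * k * d +_) (*-identityˡ d) ⟨
        2 * k * d + 1 * d         ≡⟨ *-distribʳ-+ d (2 * k) 1 ⟨
        (2 * k + 1) * d           ≤⟨ *-monoʳ-≤ (2 * k + 1) d≤t ⟩
        (2 * k + 1) * t           ∎
    enum = enumerate E
    xs : Fin (k * d + d / 2 + 1) → Fin n
    xs i = proj₁ enum (inject≤ i enough)
    xs∈E : ∀ i → E (xs i) ≡ true
    xs∈E i = proj₁ (proj₂ (proj₂ enum)) (inject≤ i enough)
    2n≤ : 2 * n ≤ (2 * k + 3) * t
    2n≤ = ≤-trans
      (hyp xs (λ eq → inject≤-injective enough enough _ _ (proj₁ (proj₂ enum) eq))
        (λ i j → ¬true⇒false λ a → disj (xs j) (xs∈E j) (nbr (xs i) (xs j) (xs∈E i) a)))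
      (*-monoʳ-≤ (2 * k + 3) (maxOf≤ _ λ i → deg≤ (xs i) (xs∈E i)))
    bound : 2 * e ≤ (2 * k + 1) * t
    bound = +-cancelʳ-≤ (2 * t) _ _ (begin
      2 * e + 2 * t             ≡⟨ *-distribˡ-+ 2 e t ⟨
      2 * (e + t)               ≤⟨ *-monoʳ-≤ 2 (count-disjoint E S disj) ⟩
      2 * n                     ≤⟨ 2n≤ ⟩
      (2 * k + 3) * t           ≡⟨ cong (_* t) (+-assoc (2 * k) 1 2) ⟨
      (2 * k + 1 + 2) * t       ≡⟨ *-distribʳ-+ t (2 * k + 1) 2 ⟩
      (2 * k + 1) * t + 2 * t   ∎)
      where open ≤-Reasoning

half-ends : ∀ {n} {s : State n} {z a b p q} → Half s z a b → Half s z p q → a ≡ p ⊎ a ≡ q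
half-ends (_ , inj₁ e) (_ , inj₁ e′) with refl ← trans (≡-sym e) e′ = inj₁ refl
half-ends (_ , inj₁ e) (_ , inj₂ e′) with refl ← trans (≡-sym e) e′ = inj₂ refl
half-ends (_ , inj₂ e) (_ , inj₁ e′) with refl ← trans (≡-sym e) e′ = inj₂ refl
half-ends (_ , inj₂ e) (_ , inj₂ e′) with refl ← trans (≡-sym e) e′ = inj₁ refl

half-cong : ∀ {n} {s s′ : State n} {z p q} → s′ z ≡ s z → Half s z p q → Half s′ z p q
half-cong eq (ne , inj₁ e) = ne , inj₁ (trans eq e)
half-cong eq (ne , inj₂ e) = ne , inj₂ (trans eq e)

half≢one : ∀ {n} {s : State n} {z p q a} → Half s z p q → s z ≢ one a
half≢one (_ , inj₁ e) e′ with () ← trans (≡-sym e) e′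
half≢one (_ , inj₂ e) e′ with () ← trans (≡-sym e) e′

module Acyclic (k : ℕ) (2≤k : 2 ≤ k) {n : ℕ} (G : Graph (Fin n)) where

  open Packing k 2≤k G
  open Packing.Valid
  open Optimum k 2≤k G

  -- The slack at c zero is passed along the path until it reaches the only centre of z.
  rotate : ∀ m {s} → Valid s → ∀ z (c : Fin (suc m) → Fin n) → Injective _≡_ _≡_ c
    → s z ≡ one (c (fromℕ m)) → load s (c zero) ≤ 2 * k
    → (∀ i → 2 ≤ load s (c (suc i)))
    → (∀ i → ∃[ z′ ] Half s z′ (c (inject₁ i)) (c (suc i)))
    → Σ[ s′ ∈ State n ] Valid s′ × suc (missing s′) ≡ missing s × splits s′ ≤ splits s
  rotate zero {s} v z c inj sz slack loads halves =
    addS s z (c zero) , add-valid v z (c zero) def (sends-adj v z _ zc) (sends-ctr v z _ zc) slack ,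
    add-missing s z (c zero) def , ≤-reflexive splits-eq
    where
    def : 1 ≤ miss (s z)
    def rewrite sz = ≤-refl
    zc : 1 ≤ mult (s z) (c zero)
    zc rewrite sz | δ-refl (c zero) = ≤-refl
    splits-eq : splits (addS s z (c zero)) ≡ splits s
    splits-eq = begin
      splits (addS s z (c zero))                ≡⟨ +-identityʳ _ ⟨
      splits (addS s z (c zero)) + 0            ≡⟨ cong (λ t → splits (addS s z (c zero)) + split t) sz ⟨
      splits (addS s z (c zero)) + split (s z)  ≡⟨ sum-upd split s z (add (s z) (c zero)) ⟩
      splits s + split (add (s z) (c zero))     ≡⟨ cong (λ t → splits s + split (add t (c zero))) sz ⟩
      splits s + split (two (c zero) (c zero))  ≡⟨ cong (splits s +_) (split-same (c zero)) ⟩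
      splits s + 0                              ≡⟨ +-identityʳ _ ⟩
      splits s ∎
      where open ≡-Reasoning
  rotate (suc m) {s} v z c inj sz slack loads halves =
    let t , tv , tm , ts = rotate m valid z (c ∘ suc) (λ e → suc-injective (inj e)) (trans (unchanged z≢z₁) sz)
                             slack′ loads′ halves′
    in t , tv , trans tm missing-eq , ≤-trans ts (≤-trans (n≤1+n _) (≤-reflexive splits-eq))
    where
    z₁ = proj₁ (halves zero)
    h₁ = proj₂ (halves zero)
    open Push v h₁ slack (loads zero)
    z≢z₁ : z ≢ z₁
    z≢z₁ refl = half≢one {s = s} h₁ sz
    apart : ∀ i → c zero ≢ c (suc i)
    apart i e with () ← inj e
    slack′ : load s′ (c (suc zero)) ≤ 2 * k
    slack′ = +-cancelʳ-≤ 1 _ _ (begin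
      load s′ c₁ + 1            ≡⟨ cong (load s′ c₁ +_) (δ-refl c₁) ⟨
      load s′ c₁ + δ c₁ c₁      ≡⟨ load-eq c₁ ⟩
      load s c₁ + δ (c zero) c₁ ≡⟨ cong (load s c₁ +_) (δ-≢ (apart zero)) ⟩
      load s c₁ + 0             ≡⟨ +-identityʳ _ ⟩
      load s c₁                 ≤⟨ load-hi v c₁ (sends-ctr v z₁ c₁ zq) ⟩
      2 * k + 1                 ∎)
      where
      open ≤-Reasoning
      c₁ = c (suc zero)
    loads′ : ∀ i → 2 ≤ load s′ (c (suc (suc i)))
    loads′ i = subst (2 ≤_) (≡-sym eq) (loads (suc i))
      where
      c₂ = c (suc (suc i))
      c₁≢c₂ : c (suc zero) ≢ c₂
      c₁≢c₂ e with () ← inj e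
      eq : load s′ c₂ ≡ load s c₂
      eq = trans (≡-sym (+-identityʳ _)) (trans (cong (load s′ c₂ +_) (≡-sym (δ-≢ c₁≢c₂)))
             (trans (load-eq c₂) (trans (cong (load s c₂ +_) (δ-≢ (apart (suc i)))) (+-identityʳ _))))
    halves′ : ∀ i → ∃[ z′ ] Half s′ z′ (c (suc (inject₁ i))) (c (suc (suc i)))
    halves′ i with halves (suc i)
    -- The pushed vertex `z₁` cannot serve a later link: one of its ends was `c zero`, which does
    -- not occur again on the path.
    ... | z′ , h with z′ ≟ z₁
    ...   | no ne = z′ , half-cong {s = s} {s′} (unchanged ne) h
    ...   | yes refl with half-ends {s = s} h₁ h
    ...     | inj₁ e = contradiction e (apart (inject₁ i))
    ...     | inj₂ e = contradiction e (apart (suc i))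

  -- Withdrawing the unit of `z` from `c zero` gives slack there, and `rotate` carries the slack
  -- round to the other centre of `z`, which takes the withdrawn unit. Nothing is missing in the
  -- end, but `z` is no longer split. Every centre involved is full by `halves-tight`, so none runs
  -- empty on the way.
  no-cycle : ∀ {s} → Valid s → SplitMin s → ∀ z m (c : Fin (suc m) → Fin n) → Injective _≡_ _≡_ c
    → Half s z (c (fromℕ m)) (c zero)
    → (∀ i → ∃[ z′ ] z′ ≢ z × Half s z′ (c (inject₁ i)) (c (suc i))) → ⊥
  no-cycle {s} v sm z m c inj h halves =
    <-irrefl refl (≤-trans (s≤s (≤-trans (sm t tv (cong Data.Nat.pred (trans tm (rem-missing s z (c zero) z0)))) ts)) (≤-reflexive splits-eq))
    where
    z0 : 1 ≤ mult (s z) (c zero)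
    z0 = half-sends {s = s} (half-swap {s = s} h)
    s₀ : State n
    s₀ = remS s z (c zero)
    tight : ∀ {z p q} → Half s z p q → load s p ≡ cap
    tight = halves-tight v sm
    load-c0 : load s (c zero) ≡ cap
    load-c0 = tight (half-swap {s = s} h)
    splits-eq : suc (splits s₀) ≡ splits s
    splits-eq = begin
      suc (splits s₀)          ≡⟨ +-comm 1 _ ⟩
      splits s₀ + 1            ≡⟨ cong (splits s₀ +_) (half-split {s = s} h) ⟨
      splits s₀ + split (s z)  ≡⟨ sum-upd split s z _ ⟩
      splits s + split (remove (s z) (c zero)) ≡⟨ cong (splits s +_) (split-remove (s z) (c zero)) ⟩
      splits s + 0             ≡⟨ +-identityʳ _ ⟩
      splits s ∎
      where open ≡-Reasoning
    slack : load s₀ (c zero) ≤ 2 * k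
    slack = +-cancelʳ-≤ 1 _ _ (≤-reflexive (trans (cong (load s₀ (c zero) +_) (≡-sym (δ-refl (c zero))))
              (trans (rem-load s z (c zero) z0 (c zero)) load-c0)))
    loads : ∀ i → 2 ≤ load s₀ (c (suc i))
    loads i = subst (2 ≤_) (≡-sym eq) (≤-trans (s≤s (s≤s z≤n)) 5≤cap)
      where
      c0≢ : c zero ≢ c (suc i)
      c0≢ e with () ← inj e
      eq : load s₀ (c (suc i)) ≡ cap
      eq = trans (≡-sym (+-identityʳ _)) (trans (cong (load s₀ (c (suc i)) +_) (≡-sym (δ-≢ c0≢)))
             (trans (rem-load s z (c zero) z0 (c (suc i))) (tight (half-swap {s = s} (proj₂ (proj₂ (halves i)))))))
    result = rotate m (rem-valid v z (c zero) z0 (subst (2 ≤_) (≡-sym load-c0) (≤-trans (s≤s (s≤s z≤n)) 5≤cap)))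
      z c inj (trans (upd-same s z _) (half-remove {s = s} h)) slack loads
      (λ i → let z′ , ne , h′ = halves i in z′ , half-cong {s = s} {s₀} (upd-other s z _ ne) h′)
    t = proj₁ result
    tv = proj₁ (proj₂ result)
    tm = proj₁ (proj₂ (proj₂ result))
    ts = proj₂ (proj₂ (proj₂ result))

-- From an optimal packing to the factor

sameImage : ∀ {A B X : Set} (φ : A → X) (g : B → X) → Injective _≡_ _≡_ φ → Injective _≡_ _≡_ g
  → (∀ a → ∃[ b ] g b ≡ φ a) → (∀ b → ∃[ a ] φ a ≡ g b)
  → Σ[ f ∈ A ↔ B ] (∀ a → g (Inverse.to f a) ≡ φ a)
sameImage φ g φ-inj g-inj to from = mk↔ₛ′ (proj₁ ∘ to) (proj₁ ∘ from)
  (λ b → g-inj (trans (proj₂ (to (proj₁ (from b)))) (proj₂ (from b))))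
  (λ a → φ-inj (trans (proj₂ (from (proj₁ (to a)))) (proj₂ (to a)))) , proj₂ ∘ to

iso-sameImage : ∀ {A B X : Set} {F : Adj X} {H : Adj B} (φ : A → X) (g : B → X)
  → Injective _≡_ _≡_ φ → Injective _≡_ _≡_ g
  → (∀ a → ∃[ b ] g b ≡ φ a) → (∀ b → ∃[ a ] φ a ≡ g b)
  → (∀ b b′ → F (g b) (g b′) ≡ H b b′)
  → Iso (λ a a′ → F (φ a) (φ a′)) H
iso-sameImage {F = F} φ g φ-inj g-inj to from eq =
  let f , fe = sameImage φ g φ-inj g-inj to from in
  f , λ a b → trans (≡-sym (cong₂ F (fe a) (fe b))) (eq _ _)

two? : ∀ {n} (c : Cell n) p q → Dec (c ≡ two p q)
two? ctr       p q = no λ ()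
two? free      p q = no λ ()
two? (one _)   p q = no λ ()
two? (two a b) p q with a ≟ p | b ≟ q
... | yes refl | yes refl = yes refl
... | no ne    | _        = no λ { refl → ne refl }
... | yes _    | no ne    = no λ { refl → ne refl }

half? : ∀ {n} (s : State n) z p q → Dec (Half s z p q)
half? s z p q = ¬? (p ≟ q) ×-dec (two? (s z) p q ⊎-dec two? (s z) q p)

true⇒T : ∀ {b} → b ≡ true → T b
true⇒T refl = _

T⇒true : ∀ {b} → T b → b ≡ true
T⇒true {true} _ = refl

double≤ : ∀ {m n} → 2 * m ≤ 2 * n + 1 → m ≤ n
double≤ {m} {n} le = ≤-pred (*-cancelˡ-< 2 m (suc n) (≤-trans (s≤s le)
  (≤-reflexive (cong suc (trans (+-comm (2 * n) 1) (≡-sym (+-suc n (n + 0))))))))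

module Extraction (k : ℕ) (2≤k : 2 ≤ k) {n : ℕ} (G : Graph (Fin n)) (s : State n)
  (v : Packing.Valid k 2≤k G s) (sm : Optimum.SplitMin k 2≤k G s)
  (full : ∀ x → miss (s x) ≡ 0) where

  open Packing k 2≤k G
  open Packing.Valid
  open Optimum k 2≤k G
  open Acyclic k 2≤k G

  data Shape (x : Fin n) : Set where
    centre  : s x ≡ ctr → Shape x
    pendant : ∀ a → s x ≡ two a a → Shape x
    sub     : ∀ a b → Half s x a b → Shape x

  shape : ∀ x → Shape x
  shape x with s x in eq | full x
  ... | ctr | _ = centre eq
  ... | two a b | _ with a ≟ b
  ...   | yes refl = pendant a eq
  ...   | no ne    = sub a b (ne , inj₁ eq)

  sends : Fin n → Fin n → Bool
  sends x y = ⌊ 1 ≤? mult (s x) y ⌋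

  sends⇒ : ∀ x y → sends x y ≡ true → 1 ≤ mult (s x) y
  sends⇒ x y = ⌊⌋-true (1 ≤? mult (s x) y)

  ⇒sends : ∀ x y → 1 ≤ mult (s x) y → sends x y ≡ true
  ⇒sends x y = ⌊⌋-intro (1 ≤? mult (s x) y)

  factor : Graph (Fin n)
  factor = record
    { adj    = λ x y → sends x y ∨ sends y x
    ; sym    = λ x y → ∨-comm (sends x y) (sends y x)
    ; irrefl = λ x → ¬true⇒false λ e → loop x (∨-true {sends x x} e)
    }
    where
    loop : ∀ x → sends x x ≡ true ⊎ sends x x ≡ true → ⊥
    loop x (inj₁ e) = sends⇒≢ctr (sends⇒ x x e) (sends-ctr v x x (sends⇒ x x e))
    loop x (inj₂ e) = loop x (inj₁ e)

  F : Adj (Fin n)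
  F = adj factor

  F-view : ∀ {x y} → F x y ≡ true → 1 ≤ mult (s x) y ⊎ 1 ≤ mult (s y) x
  F-view {x} {y} e with ∨-true {sends x y} e
  ... | inj₁ p = inj₁ (sends⇒ x y p)
  ... | inj₂ p = inj₂ (sends⇒ y x p)

  F-sent : ∀ {x y} → 1 ≤ mult (s x) y → F x y ≡ true
  F-sent {x} {y} le = ∨-introˡ (⇒sends x y le)

  F-got : ∀ {x y} → 1 ≤ mult (s y) x → F x y ≡ true
  F-got {x} {y} le = ∨-introʳ {sends x y} (⇒sends y x le)

  factor⊆G : ∀ x y → F x y ≡ true → adj G x y ≡ true
  factor⊆G x y e with F-view {x} {y} e
  ... | inj₁ p = sends-adj v x y p
  ... | inj₂ p = trans (sym G x y) (sends-adj v y x p)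

  centre-sends : ∀ {x y} → s x ≡ ctr → 1 ≤ mult (s x) y → ⊥
  centre-sends e le = sends⇒≢ctr le e

  pendant-sends : ∀ {x a} → s x ≡ two a a → 1 ≤ mult (s x) a
  pendant-sends {a = a} e rewrite e = sends-fst a a

  pendant-target : ∀ {x a y} → s x ≡ two a a → 1 ≤ mult (s x) y → a ≡ y
  pendant-target {a = a} {y} e le = sends-two-same {a = a} {y} (subst (λ c → 1 ≤ mult c y) e le)

  sub-target : ∀ {x a b y} → Half s x a b → 1 ≤ mult (s x) y → a ≡ y ⊎ b ≡ y
  sub-target {a = a} {b} {y} (_ , inj₁ e) le = sends-two (subst (λ c → 1 ≤ mult c y) e le)
  sub-target {a = a} {b} {y} (_ , inj₂ e) le with sends-two {a = b} {a} {y} (subst (λ c → 1 ≤ mult c y) e le)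
  ... | inj₁ p = inj₂ p
  ... | inj₂ p = inj₁ p

  sub-sendsˡ : ∀ {x a b} → Half s x a b → 1 ≤ mult (s x) a
  sub-sendsˡ = half-sends {s = s}

  sub-sendsʳ : ∀ {x a b} → Half s x a b → 1 ≤ mult (s x) b
  sub-sendsʳ h = half-sends {s = s} (half-swap {s = s} h)

  sub≢centre : ∀ {x a b} → Half s x a b → s x ≢ ctr
  sub≢centre h = sends⇒≢ctr (sub-sendsˡ h)

  pendant≢centre : ∀ {x a} → s x ≡ two a a → s x ≢ ctr
  pendant≢centre e = sends⇒≢ctr (pendant-sends e)

  pendant-not-sub : ∀ {x a p q} → s x ≡ two a a → ¬ Half s x p q
  pendant-not-sub {a = a} e h = contradiction (trans (≡-sym (half-split {s = s} h)) (trans (cong split e) (split-same a))) λ ()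

  sub-centreˡ : ∀ {x a b} → Half s x a b → s a ≡ ctr
  sub-centreˡ h = sends-ctr v _ _ (sub-sendsˡ h)

  sub-centreʳ : ∀ {x a b} → Half s x a b → s b ≡ ctr
  sub-centreʳ h = sends-ctr v _ _ (sub-sendsʳ h)

  pendant-centre : ∀ {x a} → s x ≡ two a a → s a ≡ ctr
  pendant-centre e = sends-ctr v _ _ (pendant-sends e)

  F-centres : ∀ {x y} → s x ≡ ctr → s y ≡ ctr → F x y ≡ true → ⊥
  F-centres ex ey e with F-view e
  ... | inj₁ p = centre-sends ex p
  ... | inj₂ p = centre-sends ey p

  F-noncentres : ∀ {x y} → s x ≢ ctr → s y ≢ ctr → F x y ≡ true → ⊥
  F-noncentres nx ny e with F-view e
  ... | inj₁ p = ny (sends-ctr v _ _ p)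
  ... | inj₂ p = nx (sends-ctr v _ _ p)

  F-from-noncentre : ∀ {x y} → s x ≢ ctr → F x y ≡ true → 1 ≤ mult (s x) y
  F-from-noncentre nx e with F-view e
  ... | inj₁ p = p
  ... | inj₂ p = contradiction (sends-ctr v _ _ p) nx

  F-from-centre : ∀ {x y} → s x ≡ ctr → F x y ≡ true → 1 ≤ mult (s y) x
  F-from-centre ex e with F-view e
  ... | inj₁ p = ⊥-elim (centre-sends ex p)
  ... | inj₂ p = p

  link? : ∀ a b → Dec (∃[ z ] Half s z a b)
  link? a b = any? (λ z → half? s z a b)

  -- Two split vertices with the same ends form a cycle through two centres. Excluding it ensures
  -- that contracting split vertices to edges yields no parallel edges.
  unique-link : ∀ {z z′ a b} → Half s z a b → Half s z′ a b → z ≡ z′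
  unique-link {z} {z′} {a} {b} h h′ with z′ ≟ z
  ... | yes e = ≡-sym e
  ... | no ne = ⊥-elim (no-cycle v sm z 1 c inj h λ { zero → z′ , ne , half-swap {s = s} h′ })
    where
    c : Fin 2 → Fin n
    c zero = b
    c (suc zero) = a
    inj : Injective _≡_ _≡_ c
    inj {zero}     {zero}     e = refl
    inj {zero}     {suc zero} e = contradiction (≡-sym e) (proj₁ h)
    inj {suc zero} {zero}     e = contradiction e (proj₁ h)
    inj {suc zero} {suc zero} e = refl

  Component : Fin n → Set
  Component u = Σ[ p ∈ ℕ ] Σ[ φ ∈ (Fin p → Fin n) ]
    Injective _≡_ _≡_ φ × (∀ w → Reach F u w ⇔ (∃[ i ] φ i ≡ w)) × InH k (comap F φ)

  -- Without split vertices every sender gives `c` both units and has no other centre. The load is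
  -- therefore even, and being at most 2k+1 it leaves room for at most k leaves.
  module Star (c : Fin n) (sc : s c ≡ ctr) (nosub : ∀ z b → ¬ Half s z c b) where

    sender-cell : ∀ {x} → 1 ≤ mult (s x) c → s x ≡ two c c
    sender-cell {x} le with shape x
    ... | centre e = ⊥-elim (centre-sends e le)
    ... | pendant a e with refl ← pendant-target e le = e
    ... | sub a b h with sub-target h le
    ...   | inj₁ refl = ⊥-elim (nosub x b h)
    ...   | inj₂ refl = ⊥-elim (nosub x a (half-swap {s = s} h))

    j : ℕ
    j = count (λ x → sends x c)

    load-eq : load s c ≡ 2 * j
    load-eq = begin
      load s c                          ≡⟨ sum-cong-≗ pointwise ⟩
      sum (λ x → 2 * ind (sends x c))   ≡⟨ sum-*ˡ 2 (λ x → ind (sends x c)) ⟩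
      2 * sum (λ x → ind (sends x c))   ≡⟨ cong (2 *_) (count-sum (λ x → sends x c)) ⟨
      2 * j                             ∎
      where
      open ≡-Reasoning
      pointwise : ∀ x → mult (s x) c ≡ 2 * ind (sends x c)
      pointwise x with 1 ≤? mult (s x) c
      ... | yes le = trans (cong (λ t → mult t c) (sender-cell le)) (mult-two-same c)
      ... | no nle = n<1⇒n≡0 (≰⇒> nle)

    1≤j : 1 ≤ j
    1≤j = *-cancelˡ-< 2 0 j (subst (1 ≤_) load-eq (load-lo v c sc))

    j≤k : j ≤ k
    j≤k = double≤ (subst (_≤ cap) load-eq (load-hi v c sc))

    leaves = enumerate (λ x → sends x c)

    φ : Fin (suc j) → Fin n
    φ zero    = c
    φ (suc i) = proj₁ leaves i

    φ-sends : ∀ i → 1 ≤ mult (s (φ (suc i))) c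
    φ-sends i = sends⇒ _ c (proj₁ (proj₂ (proj₂ leaves)) i)

    φ-noncentre : ∀ i → s (φ (suc i)) ≢ ctr
    φ-noncentre i = sends⇒≢ctr (φ-sends i)

    φ-inj : Injective _≡_ _≡_ φ
    φ-inj {zero}  {zero}  e = refl
    φ-inj {zero}  {suc i} e = contradiction (trans (cong s (≡-sym e)) sc) (φ-noncentre i)
    φ-inj {suc i} {zero}  e = contradiction (trans (cong s e) sc) (φ-noncentre i)
    φ-inj {suc i} {suc i′} e = cong suc (proj₁ (proj₂ leaves) e)

    star-adj : ∀ a b → comap F φ a b ≡ star j a b
    star-adj zero    zero    = irrefl factor c
    star-adj zero    (suc i) = F-got (φ-sends i)
    star-adj (suc i) zero    = F-sent (φ-sends i)
    star-adj (suc i) (suc i′) = ¬true⇒false (F-noncentres (φ-noncentre i) (φ-noncentre i′))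

    In : Fin n → Set
    In w = ∃[ i ] φ i ≡ w

    closed : ∀ {x y} → In x → F x y ≡ true → In y
    closed {y = y} (zero , refl) e =
      let i , q = proj₂ (proj₂ (proj₂ leaves)) y (⇒sends y c (F-from-centre sc e)) in suc i , q
    closed (suc i , refl) e =
      zero , pendant-target (sender-cell (φ-sends i)) (F-from-noncentre (φ-noncentre i) e)

    reach-c : ∀ i → Reach F (φ i) c
    reach-c zero    = here
    reach-c (suc i) = step (F-sent (φ-sends i)) here

    component : ∀ u → In u → Component u
    component u u∈@(i , refl) = suc j , φ , φ-inj ,
      (λ w → mk⇔ (λ r → Reach-closed In closed r u∈)
        λ { (i′ , refl) → Reach-trans (reach-c i) (Reach-sym (sym factor) (reach-c i′)) }) ,
      inj₁ (j , 1≤j , j≤k , ↔-id _ , star-adj)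

  module Senders (c : Fin n) where

    isPendant isSub : Fin n → Bool
    isPendant w = ⌊ two? (s w) c c ⌋
    isSub z = ⌊ any? (half? s z c) ⌋

    nP nS : ℕ
    nP = count isPendant
    nS = count isSub

    half-view : ∀ z → isSub z ≡ true → ∃[ b ] Half s z c b
    half-view z = ⌊⌋-true (any? (half? s z c))

    pend-view : ∀ w → isPendant w ≡ true → s w ≡ two c c
    pend-view w = ⌊⌋-true (two? (s w) c c)

    load-count : 2 * nP + nS ≡ load s c
    load-count = begin
      2 * nP + nS ≡⟨ cong₂ (λ a b → 2 * a + b) (count-sum isPendant) (count-sum isSub) ⟩
      2 * sum (ind ∘ isPendant) + sum (ind ∘ isSub) ≡⟨ cong (_+ sum (ind ∘ isSub)) (sum-*ˡ 2 (ind ∘ isPendant)) ⟨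
      sum (λ w → 2 * ind (isPendant w)) + sum (ind ∘ isSub) ≡⟨ ∑-distrib-+ (λ w → 2 * ind (isPendant w)) (ind ∘ isSub) ⟨
      sum (λ w → 2 * ind (isPendant w) + ind (isSub w)) ≡⟨ sum-cong-≗ pointwise ⟩
      load s c ∎
      where
      open ≡-Reasoning
      pointwise : ∀ w → 2 * ind (isPendant w) + ind (isSub w) ≡ mult (s w) c
      pointwise w with two? (s w) c c | any? (half? s w c)
      ... | yes e | yes (b , h) = ⊥-elim (pendant-not-sub e h)
      ... | yes e | no _ = ≡-sym (trans (cong (λ t → mult t c) e) (mult-two-same c))
      ... | no _ | yes (b , ne , inj₁ e) = ≡-sym (trans (cong (λ t → mult t c) e) (cong₂ _+_ (δ-refl c) (δ-≢ (λ q → ne (≡-sym q)))))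
      ... | no _ | yes (b , ne , inj₂ e) = ≡-sym (trans (cong (λ t → mult t c) e) (cong₂ _+_ (δ-≢ (λ q → ne (≡-sym q))) (δ-refl c)))
      ... | no np | no ns = ≡-sym (n<1⇒n≡0 (≰⇒> (not-sending (shape w))))
        where
        not-sending : Shape w → ¬ 1 ≤ mult (s w) c
        not-sending (centre e) le = centre-sends e le
        not-sending (pendant a e) le with refl ← pendant-target e le = np e
        not-sending (sub a b h) le with sub-target h le
        ... | inj₁ refl = ns (b , h)
        ... | inj₂ refl = ns (a , half-swap {s = s} h)

  HasSub : Fin n → Set
  HasSub c = ∃[ z ] ∃[ b ] Half s z c b

  -- This property is constant on components of the factor and separates the two kinds: stars, and
  -- trees in which every centre has a split vertex and is therefore full.
  Knotted : Fin n → Set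
  Knotted x = ∀ c → s c ≡ ctr → (x ≡ c ⊎ 1 ≤ mult (s x) c) → HasSub c

  -- An edge of the factor joins a sender to a centre. Going from a centre to a sender, an unsplit
  -- sender has no further centre, and a split one is itself the required witness at both its ends.
  knotted-closed : ∀ {x y} → Knotted x → F x y ≡ true → Knotted y
  knotted-closed {x} {y} kx e c sc at with F-view {x} {y} e
  knotted-closed {x} {y} kx e c sc (inj₁ refl) | inj₁ xy = kx c sc (inj₂ xy)
  knotted-closed {x} {y} kx e c sc (inj₂ yc)   | inj₁ xy = ⊥-elim (centre-sends (sends-ctr v x y xy) yc)
  knotted-closed {x} {y} kx e c sc (inj₁ refl) | inj₂ yx = ⊥-elim (centre-sends sc yx)
  knotted-closed {x} {y} kx e c sc (inj₂ yc)   | inj₂ yx with shape y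
  ... | centre q = ⊥-elim (centre-sends q yx)
  ... | pendant a q with refl ← pendant-target q yx | refl ← pendant-target q yc = kx x sc (inj₁ refl)
  ... | sub a b h with sub-target h yc
  ...   | inj₁ refl = y , b , h
  ...   | inj₂ refl = y , a , half-swap {s = s} h

  -- As no unit is missing, split number zero singles out the centres and the unsplit senders.
  whole : (Fin n → Bool) → Fin n → Bool
  whole K x = K x ∧ ⌊ split (s x) Data.Nat.≟ 0 ⌋

  -- K is the component of u, and ψ enumerates its centres and pendant vertices (the future V(R)).
  module Tree (u : Fin n) (ku : Knotted u)
    (K : Fin n → Bool) (reachable⇔ : ∀ w → K w ≡ true ⇔ Reach F u w)
    (r : ℕ) (ψ : Fin r → Fin n) (ψ-inj : Injective _≡_ _≡_ ψ)
    (ψ-whole : ∀ i → whole K (ψ i) ≡ true) (ψ-onto : ∀ x → whole K x ≡ true → ∃[ i ] ψ i ≡ x) where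

    K-closed : ∀ {x y} → K x ≡ true → F x y ≡ true → K y ≡ true
    K-closed kx e = Equivalence.from (reachable⇔ _) (Reach-trans (Equivalence.to (reachable⇔ _) kx) (step e here))

    K-knotted : ∀ {x} → K x ≡ true → Knotted x
    K-knotted kx = Reach-closed Knotted knotted-closed (Equivalence.to (reachable⇔ _) kx) ku

    K-connected : ∀ {x y} → K x ≡ true → K y ≡ true → Reach F x y
    K-connected kx ky = Reach-trans (Reach-sym (sym factor) (Equivalence.to (reachable⇔ _) kx)) (Equivalence.to (reachable⇔ _) ky)

    ψ-K : ∀ i → K (ψ i) ≡ true
    ψ-K i = proj₁ (∧-true (ψ-whole i))

    ψ-not-sub : ∀ i {a b} → ¬ Half s (ψ i) a b
    ψ-not-sub i h = contradiction
      (trans (≡-sym (half-split {s = s} h)) (⌊⌋-true (split (s (ψ i)) Data.Nat.≟ 0) (proj₂ (∧-true {K (ψ i)} (ψ-whole i))))) λ ()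

    index-centre : ∀ {x} → K x ≡ true → s x ≡ ctr → ∃[ i ] ψ i ≡ x
    index-centre {x} kx sx = ψ-onto x (∧-intro kx (⌊⌋-intro (split (s x) Data.Nat.≟ 0) (cong split sx)))

    index-pendant : ∀ {x a} → K x ≡ true → s x ≡ two a a → ∃[ i ] ψ i ≡ x
    index-pendant {x} {a} kx sx = ψ-onto x (∧-intro kx (⌊⌋-intro (split (s x) Data.Nat.≟ 0) (trans (cong split sx) (split-same a))))

    data Kind (i : Fin r) : Set where
      centre  : s (ψ i) ≡ ctr → Kind i
      pendant : ∀ a → s (ψ i) ≡ two a a → Kind i

    kind : ∀ i → Kind i
    kind i with shape (ψ i)
    ... | centre e    = centre e
    ... | pendant a e = pendant a e
    ... | sub a b h   = ⊥-elim (ψ-not-sub i h)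

    link : Fin r → Fin r → Bool
    link i j = ⌊ link? (ψ i) (ψ j) ⌋

    link-view : ∀ {i j} → link i j ≡ true → ∃[ z ] Half s z (ψ i) (ψ j)
    link-view {i} {j} = ⌊⌋-true (link? (ψ i) (ψ j))

    link-intro : ∀ {i j z} → Half s z (ψ i) (ψ j) → link i j ≡ true
    link-intro {i} {j} h = ⌊⌋-intro (link? (ψ i) (ψ j)) (_ , h)

    link-swap : ∀ {i j} → link i j ≡ true → link j i ≡ true
    link-swap {i} {j} e = let z , h = link-view {i} {j} e in link-intro {j} {i} (half-swap {s = s} h)

    R : Graph (Fin r)
    R = record
      { adj    = λ i j → F (ψ i) (ψ j) ∨ link i j
      ; sym    = λ i j → cong₂ _∨_ (sym factor (ψ i) (ψ j)) (bool-ext (link-swap {i} {j}) (link-swap {j} {i}))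
      ; irrefl = λ i → cong₂ _∨_ (irrefl factor (ψ i)) (¬true⇒false λ e → proj₁ (proj₂ (link-view {i} {i} e)) refl)
      }

    RA : Adj (Fin r)
    RA = adj R

    RA-view : ∀ {i j} → RA i j ≡ true → F (ψ i) (ψ j) ≡ true ⊎ ∃[ z ] Half s z (ψ i) (ψ j)
    RA-view {i} {j} e with ∨-true {F (ψ i) (ψ j)} e
    ... | inj₁ p = inj₁ p
    ... | inj₂ p = inj₂ (link-view {i} {j} p)

    RA-F : ∀ {i j} → F (ψ i) (ψ j) ≡ true → RA i j ≡ true
    RA-F e = ∨-introˡ e

    RA-link : ∀ {i j z} → Half s z (ψ i) (ψ j) → RA i j ≡ true
    RA-link {i} {j} h = ∨-introʳ {F (ψ i) (ψ j)} (link-intro {i} {j} h)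

    RA-pendant : ∀ {i j a} → s (ψ i) ≡ two a a → RA i j ≡ true → ψ j ≡ a
    RA-pendant {i} {j} e adj with RA-view {i} {j} adj
    ... | inj₁ f = ≡-sym (pendant-target e (F-from-noncentre (pendant≢centre e) f))
    ... | inj₂ (z , h) = contradiction (sub-centreˡ h) (pendant≢centre e)

    RA-centres : ∀ {i j} → s (ψ i) ≡ ctr → s (ψ j) ≡ ctr → RA i j ≡ true → ∃[ z ] Half s z (ψ i) (ψ j)
    RA-centres {i} {j} ei ej adj with RA-view {i} {j} adj
    ... | inj₁ f = ⊥-elim (F-centres ei ej f)
    ... | inj₂ l = l

    K-target : ∀ {x y} → K x ≡ true → 1 ≤ mult (s x) y → K y ≡ true
    K-target kx le = K-closed kx (F-sent le)

    isCentre : Fin r → Bool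
    isCentre i = ⌊ ctr? (s (ψ i)) ⌋

    centre-true : ∀ i → isCentre i ≡ true → s (ψ i) ≡ ctr
    centre-true i = ⌊⌋-true (ctr? (s (ψ i)))

    true-centre : ∀ i → s (ψ i) ≡ ctr → isCentre i ≡ true
    true-centre i = ⌊⌋-intro (ctr? (s (ψ i)))

    false-centre : ∀ i → s (ψ i) ≢ ctr → isCentre i ≡ false
    false-centre i ne = ¬true⇒false (ne ∘ centre-true i)

    module AtCentre (i : Fin r) (si : s (ψ i) ≡ ctr) where

      c : Fin n
      c = ψ i

      open Senders c public

      tight : load s c ≡ cap
      tight = let z , b , h = K-knotted (ψ-K i) c si (inj₁ refl) in halves-tight v sm h

      count-pendants : count (λ j → RA i j ∧ not (isCentre j)) ≡ nP
      count-pendants = ≤-antisym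
        (count-inject _ _ (λ j _ → ψ j)
          (λ j h → ⌊⌋-intro (two? (s (ψ j)) c c) (cell j h))
          (λ j _ j′ _ e → ψ-inj e))
        (count-inject _ _ (λ w h → proj₁ (idx w h))
          (λ w h → ∧-intro
            (RA-F (subst (λ x → F c x ≡ true) (≡-sym (proj₂ (idx w h))) (F-got (pendant-sends (pend-view w h)))))
            (cong not (false-centre _ λ e → pendant≢centre (pend-view w h) (trans (cong s (≡-sym (proj₂ (idx w h)))) e))))
          (λ w h w′ h′ e → trans (≡-sym (proj₂ (idx w h))) (trans (cong ψ e) (proj₂ (idx w′ h′)))))
        where
        cell : ∀ j → RA i j ∧ not (isCentre j) ≡ true → s (ψ j) ≡ two c c
        cell j h with kind j
        ... | centre e = ⊥-elim (true≢false (proj₂ (∧-true {RA i j} h)) (cong not (true-centre j e)))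
        ... | pendant a e with RA-view {i} {j} (proj₁ (∧-true {RA i j} h))
        ...   | inj₂ (z , q) = contradiction (sub-centreʳ q) (pendant≢centre e)
        ...   | inj₁ f with refl ← pendant-target e (F-from-centre si f) = e
        idx : ∀ w → isPendant w ≡ true → ∃[ j ] ψ j ≡ w
        idx w h = index-pendant (K-closed (ψ-K i) (F-got (pendant-sends (pend-view w h)))) (pend-view w h)

      -- A split vertex at `c` corresponds to the centre at its far end. One direction is injective
      -- because a split vertex has only one other end, the reverse one by `unique-link`.
      count-subs : count (λ j → RA i j ∧ isCentre j) ≡ nS
      count-subs = ≤-antisym
        (count-inject _ _ (λ j h → proj₁ (lk j h))
          (λ j h → ⌊⌋-intro (any? (half? s (proj₁ (lk j h)) c)) (ψ j , proj₂ (lk j h)))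
          (λ j h j′ h′ e → ψ-inj (other (proj₂ (lk j h)) (subst (λ z → Half s z c (ψ j′)) (≡-sym e) (proj₂ (lk j′ h′))))))
        (count-inject _ _ (λ z h → proj₁ (idx z h))
          (λ z h → ∧-intro
            (RA-link (far z h))
            (true-centre _ (sub-centreʳ (far z h))))
          (λ z h z′ h′ e → unique-link (far z h) (subst (λ j → Half s z′ c (ψ j)) (≡-sym e) (far z′ h′))))
        where
        lk : ∀ j → RA i j ∧ isCentre j ≡ true → ∃[ z ] Half s z c (ψ j)
        lk j h = RA-centres si (centre-true j (proj₂ (∧-true {RA i j} h))) (proj₁ (∧-true {RA i j} h))
        other : ∀ {z a b} → Half s z c a → Half s z c b → a ≡ b
        other h h′ with half-ends {s = s} (half-swap {s = s} h) h′
        ... | inj₁ e = contradiction (≡-sym e) (proj₁ h)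
        ... | inj₂ e = e
        idx : ∀ z (h : isSub z ≡ true) → ∃[ j ] ψ j ≡ proj₁ (half-view z h)
        idx z h = index-centre (K-target (K-closed (ψ-K i) (F-got (sub-sendsˡ q))) (sub-sendsʳ q)) (sub-centreʳ q)
          where q = proj₂ (half-view z h)
        far : ∀ z h → Half s z c (ψ (proj₁ (idx z h)))
        far z h = subst (Half s z c) (≡-sym (proj₂ (idx z h))) (proj₂ (half-view z h))

    open TreeFamily k R

    module Parity (i : Fin r) (si : s (ψ i) ≡ ctr) where

      open AtCentre i si

      balance : 2 * nP + nS ≡ 2 * k + 1
      balance = trans load-count tight

      nP≤k : nP ≤ k
      nP≤k = double≤ (≤-trans (m≤m+n _ nS) (≤-reflexive balance))

      -- Condition (a), read off from 2·nP + nS = 2k+1; the same equation is (b) with equality.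
      nS-odd : nS ≡ 2 * (k ∸ nP) + 1
      nS-odd = +-cancelˡ-≡ (2 * nP) _ _ (begin
        2 * nP + nS                   ≡⟨ balance ⟩
        2 * k + 1                     ≡⟨ cong (λ t → 2 * t + 1) (m+[n∸m]≡n nP≤k) ⟨
        2 * (nP + (k ∸ nP)) + 1       ≡⟨ cong (_+ 1) (*-distribˡ-+ 2 nP _) ⟩
        2 * nP + 2 * (k ∸ nP) + 1     ≡⟨ +-assoc (2 * nP) _ 1 ⟩
        2 * nP + (2 * (k ∸ nP) + 1)   ∎)
        where open ≡-Reasoning

      degree : deg RA i ≡ nS + nP
      degree = trans (count-split (RA i) isCentre) (cong₂ _+_ count-subs count-pendants)

      -- With nS + nP = 1 the load would be at most 3, below `cap`. Hence the leaves of `R` are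
      -- exactly the pendant vertices.
      degree≢1 : deg RA i ≢ 1
      degree≢1 d = contradiction (≤-trans 5≤cap (≤-trans (≤-reflexive (≡-sym balance))
          (≤-trans (+-mono-≤ (*-monoʳ-≤ 2 (≤-trans (m≤n+m nP nS) le)) (≤-trans (m≤m+n nS nP) le)) ≤-refl)))
          λ { (s≤s (s≤s (s≤s ()))) }
        where
        le : nS + nP ≤ 1
        le = ≤-reflexive (trans (≡-sym degree) d)

    leaf-centre : ∀ i → s (ψ i) ≡ ctr → leaf i ≡ false
    leaf-centre i si = ¬true⇒false λ e → Parity.degree≢1 i si (≡ᵇ⇒≡ _ _ (true⇒T e))

    leaf-pendant : ∀ i {a} → s (ψ i) ≡ two a a → leaf i ≡ true
    leaf-pendant i e = T⇒true (≡⇒≡ᵇ _ _ (count-one (RA i) (proj₁ idx)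
      (RA-F (subst (λ x → F (ψ i) x ≡ true) (≡-sym (proj₂ idx)) (F-sent (pendant-sends e))))
      (λ j adj → ψ-inj (trans (RA-pendant {i} {j} e adj) (≡-sym (proj₂ idx))))))
      where
      idx = index-centre (K-target (ψ-K i) (pendant-sends e)) (pendant-centre e)

    leaf≡ : ∀ i → leaf i ≡ not (isCentre i)
    leaf≡ i with kind i
    ... | centre e    = trans (leaf-centre i e) (≡-sym (cong not (true-centre i e)))
    ... | pendant a e = trans (leaf-pendant i e) (≡-sym (cong not (false-centre i (pendant≢centre e))))

    internal≡ : ∀ i → internal i ≡ isCentre i
    internal≡ i = trans (cong not (leaf≡ i)) (not-involutive (isCentre i))

    internal-centre : ∀ i → internal i ≡ true → s (ψ i) ≡ ctr
    internal-centre i e = centre-true i (trans (≡-sym (internal≡ i)) e)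

    dInt≡ : ∀ i si → dInt i ≡ AtCentre.nS i si
    dInt≡ i si = trans (count-cong (λ j → cong (RA i j ∧_) (internal≡ j))) (AtCentre.count-subs i si)

    nLeaf≡ : ∀ i si → nLeaf i ≡ AtCentre.nP i si
    nLeaf≡ i si = trans (count-cong (λ j → cong (RA i j ∧_) (leaf≡ j))) (AtCentre.count-pendants i si)

    admissible : Admissible
    admissible i ti =
      (k ∸ nP , trans (dInt≡ i si) nS-odd , m∸n≤m k nP) ,
      ≤-reflexive (trans (cong₂ (λ a b → 2 * a + b) (nLeaf≡ i si) (dInt≡ i si)) balance)
      where
      si = internal-centre i (T⇒true ti)
      open AtCentre i si
      open Parity i si

    -- In the notation of step (d), r = k - nP, so k - r - nP vanishes: all pendant vertices of the
    -- factor already occur in `R`, and `T_R` only restores the split vertices.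
    no-pend : ∀ i → pend i ≡ 0
    no-pend i = by-kind (kind i)
      where
      if-zero : ∀ b {m} → m ≡ 0 → (if b then m else 0) ≡ 0
      if-zero true  e = e
      if-zero false e = refl
      if-false : ∀ {a b m} → a ≡ false → (if a ∧ b then m else 0) ≡ 0
      if-false refl = refl
      by-kind : Kind i → pend i ≡ 0
      by-kind (pendant a e) = if-false (cong not (leaf-pendant i e))
      by-kind (centre si) = if-zero (internal i ∧ (dInt i Data.Nat.<ᵇ 2 * k + 1)) (begin
        (k ∸ ((dInt i ∸ 1) / 2)) ∸ nLeaf i     ≡⟨ cong₂ (λ a b → (k ∸ ((a ∸ 1) / 2)) ∸ b) (trans (dInt≡ i si) nS-odd) (nLeaf≡ i si) ⟩
        (k ∸ ((2 * t + 1 ∸ 1) / 2)) ∸ nP       ≡⟨ cong (λ a → (k ∸ (a / 2)) ∸ nP) (trans (m+n∸n≡m (2 * t) 1) (*-comm 2 t)) ⟩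
        (k ∸ ((t * 2) / 2)) ∸ nP               ≡⟨ cong (λ a → (k ∸ a) ∸ nP) (m*n/n≡m t 2) ⟩
        (k ∸ (k ∸ nP)) ∸ nP                    ≡⟨ cong (_∸ nP) (m∸[m∸n]≡n nP≤k) ⟩
        nP ∸ nP                                ≡⟨ n∸n≡0 nP ⟩
        0                                      ∎)
        where
        open ≡-Reasoning
        open AtCentre i si
        open Parity i si
        t = k ∸ nP

    -- The vertices of R standing for x: x itself, or both ends if x subdivides an edge.
    data At (x : Fin n) (i : Fin r) : Set where
      self : ψ i ≡ x → At x i
      end  : ∀ {b} → Half s x (ψ i) b → At x i

    at-linked : ∀ {x i j} → At x i → At x j → Reach RA i j
    at-linked (self e) (self e′) with refl ← ψ-inj (trans e (≡-sym e′)) = here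
    at-linked {i = i} (self refl) (end h) = ⊥-elim (ψ-not-sub i h)
    at-linked {j = j} (end h) (self refl) = ⊥-elim (ψ-not-sub j h)
    at-linked {i = i} {j} (end h) (end h′) with ψ i ≟ ψ j | half-ends {s = s} (half-swap {s = s} h) h′
    ... | yes e | _ with refl ← ψ-inj e = here
    at-linked {i = i} {j} (end h) (end h′) | no ne | inj₁ refl = step (RA-link {i} {j} h) here
    at-linked {i = i} {j} (end h) (end h′) | no ne | inj₂ refl with half-ends {s = s} h h′
    ... | inj₁ e = contradiction e ne
    ... | inj₂ e = contradiction e (proj₁ h)

    at-centre : ∀ {y x i} → 1 ≤ mult (s y) x → ψ i ≡ x → K y ≡ true → ∃[ j ] At y j × Reach RA i j
    at-centre {y} {i = i} le refl ky with shape y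
    ... | centre e = ⊥-elim (centre-sends e le)
    ... | pendant a e = let j , q = index-pendant ky e in
          j , self q , step (RA-F (subst (λ t → F (ψ i) t ≡ true) (≡-sym q) (F-got le))) here
    ... | sub a b h with sub-target h le
    ...   | inj₁ refl = i , end h , here
    ...   | inj₂ refl = i , end (half-swap {s = s} h) , here

    -- Lifts one edge of the factor to a walk in `R`. Passing through a split vertex may require
    -- switching to its other end, which `at-linked` does along the contracted edge.
    at-step : ∀ {x y i} → K x ≡ true → At x i → F x y ≡ true → ∃[ j ] At y j × Reach RA i j
    at-step {x} {y} {i} kx at e with F-view {x} {y} e
    at-step kx (self q) e | inj₂ yx = at-centre yx q (K-closed kx e)
    at-step kx (end h) e | inj₂ yx = contradiction (sends-ctr v _ _ yx) (sub≢centre h)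
    at-step {x} {y} {i} kx at e | inj₁ xy =
      let j , q = index-centre (K-closed kx e) (sends-ctr v x y xy)
          l , al , p = at-centre {x} {y} {j} xy q kx
      in j , self q , Reach-trans (at-linked at al) (Reach-sym (sym R) p)

    at-connected : ∀ {x y i j} → K x ≡ true → Reach F x y → At x i → At y j → Reach RA i j
    at-connected kx here ai aj = at-linked ai aj
    at-connected kx (step e p) ai aj =
      let l , al , q = at-step kx ai e in Reach-trans q (at-connected (K-closed kx e) p al aj)

    connected : ∀ i j → Reach RA i j
    connected i j = at-connected (ψ-K i) (K-connected (ψ-K i) (ψ-K j)) (self refl) (self refl)

    -- Needed to keep pendant vertices off cycles of `R`: such a vertex has a single neighbour
    -- there.
    cycle-neighbours : ∀ {l} (c : Fin (3 + l) → Fin r) → IsCycle RA l c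
      → ∀ i → ∃[ j ] ∃[ j′ ] j ≢ j′ × RA (c i) (c j) ≡ true × RA (c i) (c j′) ≡ true
    cycle-neighbours c (inj , edge , close) zero =
      suc zero , fromℕ _ , (λ ()) , edge zero , trans (sym R (c zero) _) close
    cycle-neighbours c (inj , edge , close) (suc i) with view i
    ... | ‵fromℕ = inject₁ (fromℕ _) , zero , (λ ()) , trans (sym R _ (c (inject₁ (fromℕ _)))) (edge (fromℕ _)) , close
    ... | ‵inject₁ i = inject₁ (inject₁ i) , suc (suc i) , apart ,
            trans (sym R _ (c (inject₁ (inject₁ i)))) (edge (inject₁ i)) , edge (suc i)
      where
      apart : inject₁ (inject₁ i) ≢ suc (suc i)
      apart e = <⇒≢ (m≤n⇒m≤1+n (n<1+n (toℕ i))) (trans (≡-sym (trans (toℕ-inject₁ (inject₁ i)) (toℕ-inject₁ i))) (cong toℕ e))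

    acyclic : ∀ l (c : Fin (3 + l) → Fin r) → IsCycle RA l c → ⊥
    acyclic l c cyc@(inj , edge , close) =
      no-cycle v sm z (2 + l) (ψ ∘ c) (inj ∘ ψ-inj) hz λ i → let z′ , h = edge-link i in z′ , fresh i h , h
      where
      on-centre : ∀ i → s (ψ (c i)) ≡ ctr
      on-centre i with kind (c i)
      ... | centre e = e
      ... | pendant a e = let j , j′ , ne , p , q = cycle-neighbours c cyc i in
            contradiction (inj (ψ-inj (trans (RA-pendant {c i} {c j} e p) (≡-sym (RA-pendant {c i} {c j′} e q))))) ne
      last-link = RA-centres {c (fromℕ (2 + l))} {c zero} (on-centre _) (on-centre zero) close
      z = proj₁ last-link
      hz = proj₂ last-link
      edge-link : ∀ i → ∃[ z′ ] Half s z′ (ψ (c (inject₁ i))) (ψ (c (suc i)))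
      edge-link i = RA-centres {c (inject₁ i)} {c (suc i)} (on-centre _) (on-centre _) (edge i)
      -- If the closing edge shared its split vertex with an earlier edge, both would have the same
      -- ends. This would force i = 0 and make the second vertex of the cycle its last, whereas a
      -- cycle has at least three.
      fresh : ∀ i {z′} → Half s z′ (ψ (c (inject₁ i))) (ψ (c (suc i))) → z′ ≢ z
      fresh i h refl with half-ends {s = s} h hz
      ... | inj₁ e = fromℕ≢inject₁ (≡-sym (inj (ψ-inj e)))
      ... | inj₂ e with half-ends {s = s} (half-swap {s = s} h) hz
      ...   | inj₂ e′ with () ← inj (ψ-inj e′)
      fresh zero h refl | inj₂ e | inj₁ e′ with () ← inj (ψ-inj e′)
      fresh (suc i) h refl | inj₂ e | inj₁ e′ with () ← inj (ψ-inj e)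

    some-vertex : Fin r
    some-vertex with shape u
    ... | centre e    = proj₁ (index-centre Ku e)
      where Ku = Equivalence.from (reachable⇔ u) here
    ... | pendant a e = proj₁ (index-pendant Ku e)
      where Ku = Equivalence.from (reachable⇔ u) here
    ... | sub a b h   = proj₁ (index-centre (K-target Ku (sub-sendsˡ h)) (sub-centreˡ h))
      where Ku = Equivalence.from (reachable⇔ u) here

    isTree : IsTree R
    isTree = nonempty some-vertex , connected , acyclic
      where
      nonempty : ∀ {m} → Fin m → 1 ≤ m
      nonempty {suc m} _ = s≤s z≤n

    subOK-view : ∀ {a b} → subOK a b ≡ true → toℕ a < toℕ b × ∃[ z ] Half s z (ψ a) (ψ b)
    subOK-view {a} {b} e =
      let lt , e′ = ∧-true {toℕ a Data.Nat.<ᵇ toℕ b} e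
          ab , e″ = ∧-true {RA a b} e′
          ia , ib = ∧-true {internal a} e″
      in <ᵇ⇒< _ _ (true⇒T lt) , RA-centres {a} {b} (internal-centre a ia) (internal-centre b ib) ab

    subOK-intro : ∀ {a b z} → toℕ a < toℕ b → Half s z (ψ a) (ψ b) → subOK a b ≡ true
    subOK-intro {a} {b} lt h = ∧-intro (T⇒true (<⇒<ᵇ lt)) (∧-intro (RA-link {a} {b} h)
      (∧-intro (trans (internal≡ a) (true-centre a (sub-centreˡ h))) (trans (internal≡ b) (true-centre b (sub-centreʳ h)))))

    g : VT → Fin n
    g (inj₁ i) = ψ i
    g (inj₂ (inj₁ ((a , b) , t))) = proj₁ (proj₂ (subOK-view {a} {b} (T⇒true t)))
    -- A dummy value: `no-Pend` shows that there is no vertex of this kind.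
    g (inj₂ (inj₂ (i , f))) = ψ i

    g-half : ∀ {a b} t → Half s (g (inj₂ (inj₁ ((a , b) , t)))) (ψ a) (ψ b)
    g-half {a} {b} t = proj₂ (proj₂ (subOK-view {a} {b} (T⇒true t)))

    no-Pend : Pend → ⊥
    no-Pend (i , f) with () ← subst Fin (no-pend i) f

    -- `Sub` lists each edge once, with increasing ends, so the unordered ends of a split vertex
    -- determine the ordered pair.
    same-ends : ∀ {z a b a′ b′} → toℕ a < toℕ b → toℕ a′ < toℕ b′
      → Half s z (ψ a) (ψ b) → Half s z (ψ a′) (ψ b′) → a ≡ a′ × b ≡ b′
    same-ends lt lt′ h h′ with half-ends {s = s} h h′ | half-ends {s = s} (half-swap {s = s} h) h′
    ... | inj₁ e | inj₂ e′ = ψ-inj e , ψ-inj e′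
    ... | inj₁ e | inj₁ e′ = contradiction (trans e (≡-sym e′)) (proj₁ h)
    ... | inj₂ e | inj₂ e′ = contradiction (trans e (≡-sym e′)) (proj₁ h)
    ... | inj₂ e | inj₁ e′ with refl ← ψ-inj e | refl ← ψ-inj e′ = contradiction lt′ (<-asym lt)

    g-inj : Injective _≡_ _≡_ g
    g-inj {inj₂ (inj₂ p)} {_} e = ⊥-elim (no-Pend p)
    g-inj {inj₁ _} {inj₂ (inj₂ p)} e = ⊥-elim (no-Pend p)
    g-inj {inj₂ (inj₁ _)} {inj₂ (inj₂ p)} e = ⊥-elim (no-Pend p)
    g-inj {inj₁ i} {inj₁ j} e = cong inj₁ (ψ-inj e)
    g-inj {inj₁ i} {inj₂ (inj₁ (_ , t))} e = ⊥-elim (ψ-not-sub i (subst (λ z → Half s z _ _) (≡-sym e) (g-half t)))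
    g-inj {inj₂ (inj₁ (_ , t))} {inj₁ j} e = ⊥-elim (ψ-not-sub j (subst (λ z → Half s z _ _) e (g-half t)))
    g-inj {inj₂ (inj₁ ((a , b) , t))} {inj₂ (inj₁ ((a′ , b′) , t′))} e
      with refl , refl ← same-ends {a = a} {b} {a′} {b′} (proj₁ (subOK-view {a} {b} (T⇒true t))) (proj₁ (subOK-view {a′} {b′} (T⇒true t′)))
             (g-half t) (subst (λ z → Half s z _ _) (≡-sym e) (g-half t′))
      = cong (λ t → inj₂ (inj₁ ((a , b) , t))) (T-irrelevant t t′)

    g-K : ∀ w → K (g w) ≡ true
    g-K (inj₁ i) = ψ-K i
    g-K (inj₂ (inj₁ ((a , b) , t))) = K-closed (ψ-K a) (F-got (sub-sendsˡ (g-half t)))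
    g-K (inj₂ (inj₂ p)) = ⊥-elim (no-Pend p)

    g-onto : ∀ x → K x ≡ true → ∃[ w ] g w ≡ x
    g-onto x kx with shape x
    ... | centre e    = let i , q = index-centre kx e in inj₁ i , q
    ... | pendant a e = let i , q = index-pendant kx e in inj₁ i , q
    ... | sub p q h with index-centre (K-target kx (sub-sendsˡ h)) (sub-centreˡ h) | index-centre (K-target kx (sub-sendsʳ h)) (sub-centreʳ h)
    -- The two ends must be put into the order that `subOK` prescribes; `unique-link` then
    -- identifies the split vertex chosen by `g` with the given one.
    ...   | a , refl | b , refl with <-cmp (toℕ a) (toℕ b)
    ...     | tri≈ _ e _ = contradiction (cong ψ (toℕ-injective e)) (proj₁ h)
    ...     | tri< lt _ _ = inj₂ (inj₁ ((a , b) , t)) , unique-link (g-half t) h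
      where t = true⇒T (subOK-intro lt h)
    ...     | tri> _ _ lt = inj₂ (inj₁ ((b , a) , t)) , unique-link (g-half t) (half-swap {s = s} h)
      where t = true⇒T (subOK-intro lt (half-swap {s = s} h))

    F-sub : ∀ i {a b z} → Half s z (ψ a) (ψ b) → F (ψ i) z ≡ (i == a) ∨ (i == b)
    F-sub i {a} {b} {z} h = bool-ext there back
      where
      there : F (ψ i) z ≡ true → (i == a) ∨ (i == b) ≡ true
      there e with sub-target h (F-from-noncentre (sub≢centre h) (trans (sym factor z (ψ i)) e))
      ... | inj₁ q = ∨-introˡ (⌊⌋-intro (i ≟ a) (≡-sym (ψ-inj q)))
      ... | inj₂ q = ∨-introʳ {i == a} (⌊⌋-intro (i ≟ b) (≡-sym (ψ-inj q)))
      back : (i == a) ∨ (i == b) ≡ true → F (ψ i) z ≡ true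
      back e with ∨-true {i == a} e
      ... | inj₁ q with refl ← ⌊⌋-true (i ≟ a) q = F-got (sub-sendsˡ h)
      ... | inj₂ q with refl ← ⌊⌋-true (i ≟ b) q = F-got (sub-sendsʳ h)

    g-adj : ∀ w w′ → F (g w) (g w′) ≡ adjT w w′
    g-adj (inj₂ (inj₂ p)) _ = ⊥-elim (no-Pend p)
    g-adj (inj₁ _) (inj₂ (inj₂ p)) = ⊥-elim (no-Pend p)
    g-adj (inj₂ (inj₁ _)) (inj₂ (inj₂ p)) = ⊥-elim (no-Pend p)
    g-adj (inj₁ i) (inj₂ (inj₁ ((a , b) , t))) = F-sub i {a} {b} (g-half t)
    g-adj (inj₂ (inj₁ ((a , b) , t))) (inj₁ i) = trans (sym factor _ (ψ i)) (F-sub i {a} {b} (g-half t))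
    g-adj (inj₂ (inj₁ (_ , t))) (inj₂ (inj₁ (_ , t′))) = ¬true⇒false (F-noncentres (sub≢centre (g-half t)) (sub≢centre (g-half t′)))
    g-adj (inj₁ i) (inj₁ j) = bool-ext there back
      where
      there : F (ψ i) (ψ j) ≡ true → RA i j ∧ (leaf i ∨ leaf j) ≡ true
      there e with kind i | kind j
      ... | pendant a q | _ = ∧-intro (RA-F {i} {j} e) (∨-introˡ (leaf-pendant i q))
      ... | centre _ | pendant a q = ∧-intro (RA-F {i} {j} e) (∨-introʳ {leaf i} (leaf-pendant j q))
      ... | centre p | centre q = ⊥-elim (F-centres p q e)
      back : RA i j ∧ (leaf i ∨ leaf j) ≡ true → F (ψ i) (ψ j) ≡ true
      back e with ∧-true {RA i j} e
      ... | adj , lf with RA-view {i} {j} adj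
      ...   | inj₁ f = f
      ...   | inj₂ (z , h) with ∨-true {leaf i} lf
      ...     | inj₁ li = ⊥-elim (true≢false li (leaf-centre i (sub-centreˡ h)))
      ...     | inj₂ lj = ⊥-elim (true≢false lj (leaf-centre j (sub-centreʳ h)))

    component : Component u
    component = count K , φ , proj₁ (proj₂ enumK) ,
      (λ w → mk⇔ (λ p → φ-onto w (Equivalence.from (reachable⇔ w) p))
                 λ { (i , refl) → Equivalence.to (reachable⇔ _) (φ-K i) }) ,
      inj₂ (r , R , isTree , admissible ,
        iso-sameImage {F = F} {adjT} φ g (proj₁ (proj₂ enumK)) g-inj
          (λ i → g-onto (φ i) (φ-K i)) (λ w → φ-onto (g w) (g-K w)) g-adj)
      where
      enumK = enumerate K
      φ = proj₁ enumK
      φ-K = proj₁ (proj₂ (proj₂ enumK))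
      φ-onto = proj₂ (proj₂ (proj₂ enumK))

  tree-component : ∀ u → Knotted u → Component u
  tree-component u ku =
    let K = Closure.reachable F u
        ψ , ψ-inj , ψ-whole , ψ-onto = enumerate (whole K)
    in Tree.component u ku K (Closure.reachable⇔ F u) (count (whole K)) ψ ψ-inj ψ-whole ψ-onto

  hasSub? : ∀ c → Dec (HasSub c)
  hasSub? c = any? λ z → any? λ b → half? s z c b

  component : ∀ u → Component u
  component u with shape u
  ... | sub a b h = tree-component u λ where
          c sc (inj₁ refl) → contradiction sc (sub≢centre h)
          c sc (inj₂ le) → case-target h (sub-target h le)
    where
    case-target : ∀ {a b c} → Half s u a b → a ≡ c ⊎ b ≡ c → HasSub c
    case-target h (inj₁ refl) = u , _ , h
    case-target h (inj₂ refl) = u , _ , half-swap {s = s} h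
  ... | centre e with hasSub? u
  ...   | no none = Star.component u e (λ z b h → none (z , b , h)) u (zero , refl)
  ...   | yes some = tree-component u λ where
          c sc (inj₁ refl) → some
          c sc (inj₂ le) → ⊥-elim (centre-sends e le)
  component u | pendant a e with hasSub? a
  -- A pendant vertex inherits the kind of its only centre, so the component is built around that
  -- centre.
  ... | no none = Star.component a (pendant-centre e) nosub u
                    (Star.closed a (pendant-centre e) nosub (zero , refl) (F-got (pendant-sends e)))
    where
    nosub : ∀ z b → ¬ Half s z a b
    nosub z b h = none (z , b , h)
  ... | yes some = tree-component u λ where
          c sc (inj₁ refl) → contradiction sc (pendant≢centre e)
          c sc (inj₂ le) → subst HasSub (pendant-target e le) some

  hasFactor : HasFactor k G
  hasFactor = factor , factor⊆G , component

theorem1p4 : (k : ℕ) → 2 ≤ k → (n : ℕ) → (G : Graph (Fin n)) → (δ : ℕ)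
    → IsMinDegree G δ → 1 ≤ δ
    → (∀ (xs : Fin (k * δ + δ / 2 + 1) → Fin n)
    → Injective _≡_ _≡_ xs
    → (∀ i j → adj G (xs i) (xs j) ≡ false)
    → 2 * n ≤ (2 * k + 3) * maxOf (deg (adj G) ∘ xs))
    → HasFactor k G
theorem1p4 k 2≤k n G δ (δ≤deg , _) _ degree-condition =
  let s , v , mm , sm = optimum in
  Extraction.hasFactor k 2≤k G s v sm
    (NoneMissing.none-missing (isolated-bound k 2≤k G δ δ≤deg degree-condition) v mm (good v mm sm))
  where open Optimum k 2≤k G
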